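{- Let $T$ be any tree poset of height $2$. Then $$La_{rp}(n,T)= \left(1 + O_T\left(\sqrt{\frac{\log n}{n}}\right)\right) \binom{n}{\lfloor n/2 \rfloor},$$ i.e., there is a constant $C_T$ depending only on $T$ such that for all sufficiently large $n$, $$\left|\frac{La_{rp}(n,T)}{\binom{n}{\lfloor n/2\rfloor}}-1\right|\le C_T\sqrt{\frac{\log n}{n}}.$$
   Context: For a finite poset $P$, its Hasse diagram is the graph on the elements of $P$ in which $x,y$ are adjacent if $x<y$ and there is no $z\in P$ with $x<z<y$. A tree poset is a poset whose Hasse diagram is a tree. The height of a poset is the maximum number of elements in a chain. A poset $P$ is graded with rank function $\rho$ if $\rho(y)=\rho(x)+1$ whenever $y$ covers $x$ (for a tree poset such a rank function exists and is determined up to an additive constant). For a family $\mathcal F$ of subsets of $[n]=\{1,\dots,n\}$, a subfamily $\mathcal G\subseteq\mathcal F$ is a rank-preserving copy of the graded poset $P$ if there is a bijection $\phi:P\to\mathcal G$ such that $\phi(x)\subseteq\phi(y)$ whenever $x\le_P y$, and $|\phi(x)|=|\phi(y)|$ whenever $\rho(x)=\rho(y)$. $La_{rp}(n,P)$ denotes the maximum size of a family $\mathcal F\subseteq 2^{[n]}$ containing no rank-preserving copy of $P$. -}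

module Defs where

open import Level using (0ℓ)
open import Data.Nat using (ℕ; suc; _≤_; _*_; _/_; ∣_-_∣)
open import Data.Nat.Combinatorics using (_C_)
open import Data.Nat.Logarithm using (⌊log₂_⌋)
open import Data.Fin using (Fin)
open import Data.Fin.Subset using (Subset; _⊆_; ∣_∣)
open import Data.List using (List; []; _∷_; _++_; [_]; length)
open import Data.List.Membership.Propositional using (_∈_)
open import Data.List.Relation.Unary.Unique.Propositional using (Unique)
open import Data.List.Relation.Unary.AllPairs using (AllPairs)
open import Data.List.Relation.Unary.Linked using (Linked)
open import Data.Product using (Σ; ∃; _×_)
open import Data.Sum using (_⊎_)
open import Relation.Binary.PropositionalEquality using (_≡_; _≢_)
open import Relation.Binary.Structures using (IsPartialOrder)
open import Relation.Nullary using (¬_)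
open import Function.Definitions using (Injective)

record FinPoset : Set₁ where
  field
    size           : ℕ
    _≼_            : Fin size → Fin size → Set
    isPartialOrder : IsPartialOrder _≡_ _≼_

module _ (P : FinPoset) where
  open FinPoset P

  Elt : Set
  Elt = Fin size

  _≺_ : Elt → Elt → Set
  x ≺ y = x ≼ y × x ≢ y

  Covers : Elt → Elt → Set
  Covers x y = x ≺ y × (∀ z → ¬ (x ≺ z × z ≺ y))

  HasseAdj : Elt → Elt → Set
  HasseAdj x y = Covers x y ⊎ Covers y x

  data Walk : Elt → Elt → Set where
    here : ∀ {x} → Walk x x
    step : ∀ {x y z} → HasseAdj x y → Walk y z → Walk x z

  HasseConnected : Set
  HasseConnected = ∀ x y → Walk x y

  HasseHasCycle : Set
  HasseHasCycle = Σ Elt λ v → Σ (List Elt) λ ws →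
    2 ≤ length ws × Unique (v ∷ ws) × Linked HasseAdj (v ∷ ws ++ [ v ])

  IsTreePoset : Set
  IsTreePoset = 1 ≤ size × HasseConnected × ¬ HasseHasCycle

  Comparable : Elt → Elt → Set
  Comparable x y = x ≼ y ⊎ y ≼ x

  IsChain : List Elt → Set
  IsChain c = Unique c × AllPairs Comparable c

  HeightIs : ℕ → Set
  HeightIs h = (Σ (List Elt) λ c → IsChain c × length c ≡ h)
             × (∀ c → IsChain c → length c ≤ h)

  IsRankFunction : (Elt → ℕ) → Set
  IsRankFunction ρ = ∀ x y → Covers x y → ρ y ≡ suc (ρ x)

  -- rank-preserving copy of P inside the family F ⊆ 2^[n]
  -- (image of an injective φ : P → F, i.e. a bijection onto a subfamily)
  HasRPCopy : (n : ℕ) → List (Subset n) → Set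
  HasRPCopy n F = Σ (Elt → ℕ) λ ρ → IsRankFunction ρ ×
    Σ (Elt → Subset n) λ φ → Injective _≡_ _≡_ φ
      × (∀ x → φ x ∈ F)
      × (∀ x y → x ≼ y → φ x ⊆ φ y)
      × (∀ x y → ρ x ≡ ρ y → ∣ φ x ∣ ≡ ∣ φ y ∣)

  IsLaRP : ℕ → ℕ → Set
  IsLaRP n m =
    (Σ (List (Subset n)) λ F → Unique F × ¬ HasRPCopy n F × length F ≡ m)
    × (∀ (F : List (Subset n)) → Unique F → ¬ HasRPCopy n F → length F ≤ m)

midBinom : ℕ → ℕ
midBinom n = n C (n / 2)

{-# OPTIONS --safe #-}

-- The middle layer is an antichain, so it contains no copy of T; this gives the lower bound.
--
-- For the upper bound, let F be T-free and let F_i be its i-th layer.  A bipartite graph all of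
-- whose degrees exceed |T| contains T, placed greedily along walks from a root (a new vertex has
-- only one placed neighbour, by acyclicity).  Deleting vertices of low degree, the containment
-- graph between F_i and F_j therefore has at most |T| (|F_i| + |F_j|) edges.  A maximal chain that
-- meets F in x sets contains at least x - 1 pairs of them, so averaging over the n! maximal chains
--   Σ_A 1 / C(n,|A|) ≤ 1 + Σ_{A ⊂ B} 1 / (C(n,|B|) C(|B|,|A|)),
-- and on the layers between n/6 and 5n/6 the edge bound makes the pair sum
-- O(|T| / n) Σ_A 1 / C(n,|A|), because C(j,i) ≥ j, and C(j,i) ≥ j(j-1)/2 unless j = i + 1.
-- The remaining layers are exponentially small.  This even yields the error term O(1 / n).
module Submission where

open import Defs
open import Data.Bool using (true; false; if_then_else_)
import Data.Bool.Properties as Bool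
open import Data.Empty using (⊥)
import Data.Fin.Properties as Fin
open import Data.Fin.Subset using (Subset; _⊆_; ∣_∣; ⊤)
open import Data.Fin.Subset.Properties using (drop-∷-⊆; out⊆; in⊆in; ⊆-refl; ⊆-max; ∣⊤∣≡n; p⊆q⇒∣p∣≤∣q∣; ∣p∣≤n)
open import Data.List using (List; []; _∷_; _++_; [_]; map; length; filter; concatMap; upTo; allFin)
open import Data.List.Membership.Propositional using (_∈_; _∉_; find; lose)
open import Data.List.Membership.Propositional.Properties
import Data.List.Membership.DecPropositional as DecMembership
open import Data.List.Properties using (length-++; length-map; length-tabulate; length-upTo; filter-accept; filter-reject)
open import Data.List.Relation.Unary.All using ([]; _∷_)
import Data.List.Relation.Unary.All.Properties as All
open import Data.List.Relation.Unary.AllPairs using ([]; _∷_)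
open import Data.List.Relation.Unary.Any using (Any; here; there; any?)
open import Data.List.Relation.Unary.Linked using (Linked; [-]; _∷_)
open import Data.List.Relation.Unary.Unique.Propositional using (Unique)
import Data.List.Relation.Unary.Unique.Propositional.Properties as Unique
open import Data.Nat
open import Data.Nat.Combinatorics using (_C_; nCk≡nC[n∸k]; nCk≡n!/k![n-k]!; k![n∸k]!∣n!; nC1≡n; nCk+nC[k+1]≡[n+1]C[k+1])
open import Data.Nat.DivMod using (m/n*n≡m; m/n*n≤m; m≡m%n+[m/n]*n; m%n<n; m*n/n≡m; /-monoˡ-≤)
open import Data.Nat.ListAction using (sum)
open import Data.Nat.Logarithm using (⌊log₂_⌋; ⌊log₂⌋-mono-≤; ⌊log₂[2^n]⌋≡n)
open import Data.Nat.Properties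
open import Data.Nat.Tactic.RingSolver using (solve-∀)
open import Data.Product using (Σ; ∃; _×_; _,_; proj₁; proj₂)
open import Data.Sum using (_⊎_; inj₁; inj₂; [_,_]′; swap)
open import Data.Vec as Vec using ([]; _∷_)
open import Data.Vec.Properties using (≡-dec; ∷-injectiveʳ)
open import Function using (_∘_)
open import Relation.Binary.Definitions using (DecidableEquality)
open import Relation.Binary.PropositionalEquality using (_≡_; _≢_; refl; sym; trans; cong; cong₂; subst; subst₂; module ≡-Reasoning)
open import Relation.Binary.Structures using (IsPartialOrder)
open import Relation.Nullary using (¬_; Dec; does; yes; no; contradiction)
open import Relation.Nullary.Decidable using (_×-dec_; ¬?; decidable-stable)

open import Algebra.Properties.CommutativeSemigroup +-commutativeSemigroup using (interchange) renaming (x∙yz≈y∙xz to +-swapˡ)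
open import Algebra.Properties.CommutativeSemigroup *-commutativeSemigroup using () renaming (x∙yz≈y∙xz to *-swapˡ)

-- Finite sums over lists and lists without repetitions

private variable
  A B : Set
  P : Set

∑ : List A → (A → ℕ) → ℕ
∑ xs f = sum (map f xs)

∑-mono : {f g : A → ℕ} (xs : List A) → (∀ {x} → x ∈ xs → f x ≤ g x) → ∑ xs f ≤ ∑ xs g
∑-mono []       f≤g = z≤n
∑-mono (x ∷ xs) f≤g = +-mono-≤ (f≤g (here refl)) (∑-mono xs (λ x∈ → f≤g (there x∈)))

∑-cong : {f g : A → ℕ} (xs : List A) → (∀ {x} → x ∈ xs → f x ≡ g x) → ∑ xs f ≡ ∑ xs g
∑-cong []       f≡g = refl
∑-cong (x ∷ xs) f≡g = cong₂ _+_ (f≡g (here refl)) (∑-cong xs (λ x∈ → f≡g (there x∈)))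

∑-zero : {f : A → ℕ} (xs : List A) → (∀ {x} → x ∈ xs → f x ≡ 0) → ∑ xs f ≡ 0
∑-zero []       f≡0 = refl
∑-zero (x ∷ xs) f≡0 = cong₂ _+_ (f≡0 (here refl)) (∑-zero xs (λ x∈ → f≡0 (there x∈)))

∑-const : (xs : List A) (c : ℕ) → ∑ xs (λ _ → c) ≡ length xs * c
∑-const []       c = refl
∑-const (x ∷ xs) c = cong (c +_) (∑-const xs c)

∑-+ : (xs : List A) (f g : A → ℕ) → ∑ xs (λ x → f x + g x) ≡ ∑ xs f + ∑ xs g
∑-+ []       f g = refl
∑-+ (x ∷ xs) f g = trans (cong (f x + g x +_) (∑-+ xs f g)) (interchange (f x) (g x) _ _)

∑-*ˡ : (c : ℕ) (xs : List A) (f : A → ℕ) → ∑ xs (λ x → c * f x) ≡ c * ∑ xs f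
∑-*ˡ c []       f = sym (*-zeroʳ c)
∑-*ˡ c (x ∷ xs) f = trans (cong (c * f x +_) (∑-*ˡ c xs f)) (sym (*-distribˡ-+ c (f x) _))

∑-*ʳ : (c : ℕ) (xs : List A) (f : A → ℕ) → ∑ xs (λ x → f x * c) ≡ ∑ xs f * c
∑-*ʳ c []       f = refl
∑-*ʳ c (x ∷ xs) f = trans (cong (f x * c +_) (∑-*ʳ c xs f)) (sym (*-distribʳ-+ c (f x) _))

∑-swap : (xs : List A) (ys : List B) (f : A → B → ℕ) →
         ∑ xs (λ x → ∑ ys (f x)) ≡ ∑ ys (λ y → ∑ xs (λ x → f x y))
∑-swap []       ys f = sym (∑-zero ys (λ _ → refl))
∑-swap (x ∷ xs) ys f =
  trans (cong (∑ ys (f x) +_) (∑-swap xs ys f)) (sym (∑-+ ys (f x) _))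

∑-map : (h : A → B) (xs : List A) (f : B → ℕ) → ∑ (map h xs) f ≡ ∑ xs (λ x → f (h x))
∑-map h []       f = refl
∑-map h (x ∷ xs) f = cong (f (h x) +_) (∑-map h xs f)

∑-insert : (xs : List A) {x : A} {ys : List A} (f : A → ℕ) →
           ∑ (xs ++ x ∷ ys) f ≡ f x + ∑ (xs ++ ys) f
∑-insert []       f = refl
∑-insert (y ∷ xs) {x} {ys} f =
  trans (cong (f y +_) (∑-insert xs f)) (+-swapˡ (f y) (f x) _)

∑-term : {xs : List A} {x : A} (f : A → ℕ) → x ∈ xs → f x ≤ ∑ xs f
∑-term f (here refl) = m≤m+n _ _
∑-term f (there x∈)  = ≤-trans (∑-term f x∈) (m≤n+m _ _)

ind : Dec P → ℕ
ind (yes _) = 1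
ind (no _)  = 0

ind-yes : (d : Dec P) → P → ind d ≡ 1
ind-yes (yes _) p = refl
ind-yes (no ¬p) p = contradiction p ¬p

ind-no : (d : Dec P) → ¬ P → ind d ≡ 0
ind-no (yes p) ¬p = contradiction p ¬p
ind-no (no _)  ¬p = refl

-- A second hit would, by injectivity of `h`, repeat an element of the list. Used with `h` the
-- identity and with `h = suc`.
∑-ind≤1 : (_≟ᴮ_ : DecidableEquality B) {h : A → B} → (∀ {x y} → h x ≡ h y → x ≡ y) →
          {xs : List A} → Unique xs → ∀ b → ∑ xs (λ x → ind (h x ≟ᴮ b)) ≤ 1
∑-ind≤1 _≟ᴮ_ h-inj [] b = z≤n
∑-ind≤1 _≟ᴮ_ {h} h-inj {x ∷ xs} ux@(_ ∷ u) b with h x ≟ᴮ b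
... | no _     = ∑-ind≤1 _≟ᴮ_ h-inj u b
... | yes refl = ≤-reflexive (cong suc (∑-zero xs λ {y} y∈ →
        ind-no (h y ≟ᴮ h x) (λ eq → Unique.Unique[x∷xs]⇒x∉xs ux (subst (_∈ xs) (h-inj eq) y∈))))

length-insert : (xs : List A) {x : A} {ys : List A} → length (xs ++ x ∷ ys) ≡ suc (length (xs ++ ys))
length-insert xs = trans (length-++ xs) (trans (+-suc _ _) (cong suc (sym (length-++ xs))))

unique-⊆-length : {xs ys : List A} → Unique xs → (∀ {x} → x ∈ xs → x ∈ ys) → length xs ≤ length ys
unique-⊆-length [] sub = z≤n
unique-⊆-length {xs = x ∷ xs} ux@(_ ∷ u) sub with ∈-∃++ (sub (here refl))
... | as , bs , refl = subst (suc (length xs) ≤_) (sym (length-insert as)) (s≤s (unique-⊆-length u sub′))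
  where
  sub′ : ∀ {y} → y ∈ xs → y ∈ as ++ bs
  sub′ y∈ with ∈-++⁻ as (sub (there y∈))
  ... | inj₁ y∈as         = ∈-++⁺ˡ y∈as
  ... | inj₂ (here refl)  = contradiction y∈ (Unique.Unique[x∷xs]⇒x∉xs ux)
  ... | inj₂ (there y∈bs) = ∈-++⁺ʳ as y∈bs

-- Otherwise `unique-⊆-length` would make `xs` no longer than `ys`. In the greedy embedding `xs`
-- lists the neighbours of a placed set and `ys` the sets already used.
fresh : DecidableEquality A → {xs : List A} (ys : List A) → Unique xs → length ys < length xs →
        ∃ λ x → x ∈ xs × x ∉ ys
fresh _≟ᴬ_ {xs} ys u ys<xs with any? (λ x → ¬? (x ∈? ys)) xs
  where open DecMembership _≟ᴬ_ using (_∈?_)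
... | yes p  = find p
... | no ¬p = contradiction ys<xs (≤⇒≯ (unique-⊆-length u λ {x} x∈ →
        decidable-stable (x ∈? ys) (λ x∉ → ¬p (lose x∈ x∉))))
  where open DecMembership _≟ᴬ_ using (_∈?_)

∈-weaken-++ : (xs : List A) {x y : A} {ys : List A} → y ∈ xs ++ ys → y ∈ xs ++ x ∷ ys
∈-weaken-++ xs y∈ = [ ∈-++⁺ˡ , ∈-++⁺ʳ xs ∘ there ]′ (∈-++⁻ xs y∈)

unique-remove : (xs : List A) {x : A} {ys : List A} → Unique (xs ++ x ∷ ys) → Unique (xs ++ ys)
unique-remove []       (_ ∷ u) = u
unique-remove (z ∷ xs) (z≢ ∷ u) with All.++⁻ xs z≢
... | z≢xs , (_ ∷ z≢ys) = All.++⁺ z≢xs z≢ys ∷ unique-remove xs u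

-- Turns a degree, which is a sum of 0/1 values, into a list of neighbours from which `fresh` can
-- choose.
∑≤length-filter : (f : A → ℕ) → (∀ x → f x ≤ 1) → (xs : List A) →
                  ∑ xs f ≤ length (filter (λ x → f x ≟ 1) xs)
∑≤length-filter f f≤1 [] = z≤n
∑≤length-filter f f≤1 (x ∷ xs) with f x ≟ 1
... | yes fx≡1 rewrite filter-accept (λ x → f x ≟ 1) {xs = xs} fx≡1 =
        +-mono-≤ (f≤1 x) (∑≤length-filter f f≤1 xs)
... | no  fx≢1 rewrite filter-reject (λ x → f x ≟ 1) {xs = xs} fx≢1 =
        +-mono-≤ (s≤s⁻¹ (≤∧≢⇒< (f≤1 x) fx≢1)) (∑≤length-filter f f≤1 xs)

-- Maximal chains of the Boolean lattice

_≟ˢ_ : ∀ {n} → DecidableEquality (Subset n)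
_≟ˢ_ = ≡-dec Bool._≟_

-- The indicator of `A ⊆ S`, as a number and by recursion on coordinates, so that degrees and counts
-- of pairs are plain sums.
inc : ∀ {n} → Subset n → Subset n → ℕ
inc []          []          = 1
inc (true ∷ A)  (false ∷ S) = 0
inc (true ∷ A)  (true ∷ S)  = inc A S
inc (false ∷ A) (_ ∷ S)     = inc A S

inc-dichotomy : ∀ {n} (A S : Subset n) → inc A S ≡ 0 ⊎ (inc A S ≡ 1 × A ⊆ S)
inc-dichotomy []          []          = inj₂ (refl , λ x∈ → x∈)
inc-dichotomy (true ∷ A)  (false ∷ S) = inj₁ refl
inc-dichotomy (true ∷ A)  (true ∷ S)  with inc-dichotomy A S
... | inj₁ eq       = inj₁ eq
... | inj₂ (eq , p) = inj₂ (eq , in⊆in p)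
inc-dichotomy (false ∷ A) (_ ∷ S)     with inc-dichotomy A S
... | inj₁ eq       = inj₁ eq
... | inj₂ (eq , p) = inj₂ (eq , out⊆ p)

⊆⇒inc : ∀ {n} {A S : Subset n} → A ⊆ S → inc A S ≡ 1
⊆⇒inc {A = []}        {[]}        p = refl
⊆⇒inc {A = true ∷ A}  {false ∷ S} p = contradiction (p Vec.here) λ ()
⊆⇒inc {A = true ∷ A}  {true ∷ S}  p = ⊆⇒inc (drop-∷-⊆ p)
⊆⇒inc {A = false ∷ A} {_ ∷ S}     p = ⊆⇒inc (drop-∷-⊆ p)

⊆∧∣≥∣⇒≡ : ∀ {n} {A S : Subset n} → A ⊆ S → ∣ S ∣ ≤ ∣ A ∣ → A ≡ S
⊆∧∣≥∣⇒≡ {A = []}        {[]}        p le = refl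
⊆∧∣≥∣⇒≡ {A = true ∷ A}  {false ∷ S} p le = contradiction (p Vec.here) λ ()
⊆∧∣≥∣⇒≡ {A = true ∷ A}  {true ∷ S}  p le = cong (true ∷_) (⊆∧∣≥∣⇒≡ (drop-∷-⊆ p) (s≤s⁻¹ le))
⊆∧∣≥∣⇒≡ {A = false ∷ A} {false ∷ S} p le = cong (false ∷_) (⊆∧∣≥∣⇒≡ (drop-∷-⊆ p) le)
⊆∧∣≥∣⇒≡ {A = false ∷ A} {true ∷ S}  p le =
  contradiction (p⊆q⇒∣p∣≤∣q∣ (drop-∷-⊆ p)) (<⇒≱ le)

-- The lower covers of `S` in the Boolean lattice: `S` with one element removed.
children : ∀ {n} → Subset n → List (Subset n)
children []          = []
children (false ∷ S) = map (false ∷_) (children S)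
children (true ∷ S)  = (false ∷ S) ∷ map (true ∷_) (children S)

children-size : ∀ {n} (S : Subset n) {S′} → S′ ∈ children S → suc ∣ S′ ∣ ≡ ∣ S ∣
children-size (false ∷ S) S′∈ with ∈-map⁻ (false ∷_) S′∈
... | _ , p , refl = children-size S p
children-size (true ∷ S) (here refl) = refl
children-size (true ∷ S) (there S′∈) with ∈-map⁻ (true ∷_) S′∈
... | _ , p , refl = cong suc (children-size S p)

-- Additive form of: a subset A of S lies below exactly |S| - |A| children of S.
∑-children-inc : ∀ {n} (A S : Subset n) →
                 ∑ (children S) (inc A) + inc A S * ∣ A ∣ ≡ inc A S * ∣ S ∣
∑-children-inc [] [] = refl
∑-children-inc (true ∷ A) (false ∷ S) =
  trans (+-identityʳ _) (trans (∑-map (false ∷_) (children S) _) (∑-zero (children S) λ _ → refl))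
∑-children-inc (false ∷ A) (false ∷ S) =
  trans (cong (_+ inc A S * ∣ A ∣) (∑-map (false ∷_) (children S) _)) (∑-children-inc A S)
∑-children-inc (true ∷ A) (true ∷ S) = begin
  ∑ (map (true ∷_) (children S)) (inc (true ∷ A)) + i * suc a
    ≡⟨ cong₂ _+_ (∑-map (true ∷_) (children S) _) (*-suc i a) ⟩
  c + (i + i * a)  ≡⟨ +-swapˡ c i (i * a) ⟩
  i + (c + i * a)  ≡⟨ cong (i +_) (∑-children-inc A S) ⟩
  i + i * ∣ S ∣    ≡⟨ *-suc i ∣ S ∣ ⟨
  i * suc ∣ S ∣    ∎
  where
  open ≡-Reasoning
  i = inc A S
  a = ∣ A ∣
  c = ∑ (children S) (inc A)
∑-children-inc (false ∷ A) (true ∷ S) = begin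
  (i + ∑ (map (true ∷_) (children S)) (inc (false ∷ A))) + i * ∣ A ∣
    ≡⟨ +-assoc i _ _ ⟩
  i + (∑ (map (true ∷_) (children S)) (inc (false ∷ A)) + i * ∣ A ∣)
    ≡⟨ cong (λ x → i + (x + i * ∣ A ∣)) (∑-map (true ∷_) (children S) _) ⟩
  i + (∑ (children S) (inc A) + i * ∣ A ∣)
    ≡⟨ cong (i +_) (∑-children-inc A S) ⟩
  i + i * ∣ S ∣    ≡⟨ *-suc i ∣ S ∣ ⟨
  i * suc ∣ S ∣    ∎
  where
  open ≡-Reasoning
  i = inc A S

-- The number of maximal chains from A up to S.
chains : ∀ {n} → Subset n → Subset n → ℕ
chains A S = inc A S * (∣ S ∣ ∸ ∣ A ∣) !

-- A maximal chain from `A` up to a different `S` passes through exactly one child of `S`.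
-- Numerically, s - a children of `S` contain `A`, where s and a are the sizes, and each carries (s
-- - a - 1)! chains. If `A` is not below `S`, both sides vanish.
∑-children-chains : ∀ {n} (A S : Subset n) → A ≢ S → ∑ (children S) (chains A) ≡ chains A S
∑-children-chains A S A≢S = begin
  ∑ (children S) (chains A)
    ≡⟨ ∑-cong (children S) (λ {S′} S′∈ →
         cong (λ k → inc A S′ * (k ∸ ∣ A ∣) !) (cong pred (children-size S S′∈))) ⟩
  ∑ (children S) (λ S′ → inc A S′ * (pred ∣ S ∣ ∸ ∣ A ∣) !)
    ≡⟨ ∑-*ʳ _ (children S) (inc A) ⟩
  ∑ (children S) (inc A) * (pred ∣ S ∣ ∸ ∣ A ∣) !
    ≡⟨ total (inc-dichotomy A S) ⟩
  chains A S ∎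
  where
  open ≡-Reasoning
  count : ℕ
  count = ∑ (children S) (inc A)
  factorial-step : ∀ s a d → s ≡ suc d + a → suc d * (pred s ∸ a) ! ≡ (s ∸ a) !
  factorial-step .(suc d + a) a d refl
    rewrite m+n∸n≡m d a | m+n∸n≡m (suc d) a = refl
  total : inc A S ≡ 0 ⊎ (inc A S ≡ 1 × A ⊆ S) → count * (pred ∣ S ∣ ∸ ∣ A ∣) ! ≡ chains A S
  total (inj₁ eq) = trans (cong (_* (pred ∣ S ∣ ∸ ∣ A ∣) !) count≡0) (sym (cong (_* (∣ S ∣ ∸ ∣ A ∣) !) eq))
    where
    count≡0 : count ≡ 0
    count≡0 = m+n≡0⇒m≡0 count (trans (∑-children-inc A S) (cong (_* ∣ S ∣) eq))
  total (inj₂ (eq , A⊆S)) = begin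
    count * (pred ∣ S ∣ ∸ ∣ A ∣) !  ≡⟨ cong (_* (pred ∣ S ∣ ∸ ∣ A ∣) !) count≡ ⟩
    suc d * (pred ∣ S ∣ ∸ ∣ A ∣) !  ≡⟨ factorial-step ∣ S ∣ ∣ A ∣ d (sym d+∣A∣≡∣S∣) ⟩
    (∣ S ∣ ∸ ∣ A ∣) !               ≡⟨ *-identityˡ _ ⟨
    1 * (∣ S ∣ ∸ ∣ A ∣) !           ≡⟨ cong (_* (∣ S ∣ ∸ ∣ A ∣) !) eq ⟨
    chains A S                      ∎
    where
    ∣A∣<∣S∣ : ∣ A ∣ < ∣ S ∣
    ∣A∣<∣S∣ = ≰⇒> (λ le → A≢S (⊆∧∣≥∣⇒≡ A⊆S le))
    d : ℕ
    d = ∣ S ∣ ∸ suc ∣ A ∣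
    d+∣A∣≡∣S∣ : suc d + ∣ A ∣ ≡ ∣ S ∣
    d+∣A∣≡∣S∣ = trans (sym (+-suc d ∣ A ∣)) (m∸n+n≡m ∣A∣<∣S∣)
    count≡ : count ≡ suc d
    count≡ = +-cancelʳ-≡ ∣ A ∣ count (suc d) (begin
      count + ∣ A ∣            ≡⟨ cong (count +_) (*-identityˡ ∣ A ∣) ⟨
      count + 1 * ∣ A ∣        ≡⟨ cong (λ i → count + i * ∣ A ∣) eq ⟨
      count + inc A S * ∣ A ∣  ≡⟨ ∑-children-inc A S ⟩
      inc A S * ∣ S ∣          ≡⟨ cong (_* ∣ S ∣) eq ⟩
      1 * ∣ S ∣                ≡⟨ *-identityˡ ∣ S ∣ ⟩
      ∣ S ∣                    ≡⟨ d+∣A∣≡∣S∣ ⟨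
      suc d + ∣ A ∣            ∎)

chains-self : ∀ {n} (S : Subset n) → chains S S ≡ 1
chains-self S rewrite ⊆⇒inc (⊆-refl {x = S}) | n∸n≡0 ∣ S ∣ = refl

-- Only `A = S` breaks equality: no child of `S` contains `S`, while `chains S S` is 1.
∑-children-chains≤ : ∀ {n} (A S : Subset n) → ∑ (children S) (chains A) ≤ chains A S
∑-children-chains≤ A S with A ≟ˢ S
... | no A≢S   = ≤-reflexive (∑-children-chains A S A≢S)
... | yes refl = ≤-trans (≤-reflexive (∑-zero (children A) none)) z≤n
  where
  none : ∀ {S′} → S′ ∈ children A → chains A S′ ≡ 0
  none {S′} S′∈ with inc-dichotomy A S′
  ... | inj₁ eq       = cong (_* (∣ S′ ∣ ∸ ∣ A ∣) !) eq
  ... | inj₂ (_ , A⊆) = contradiction (p⊆q⇒∣p∣≤∣q∣ A⊆) (<⇒≱ (≤-reflexive (children-size A S′∈)))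

length-children : ∀ {n} (S : Subset n) → length (children S) ≡ ∣ S ∣
length-children []          = refl
length-children (false ∷ S) = trans (length-map _ (children S)) (length-children S)
length-children (true ∷ S)  = cong suc (trans (length-map _ (children S)) (length-children S))

-- `∣ S ∣ !` counts the maximal chains from the empty set to `S`, sorted here by the child they pass
-- through. Equality fails only for the empty set, which has one chain but no child.
∑-children-factorial≤ : ∀ {n} (S : Subset n) → ∑ (children S) (λ S′ → ∣ S′ ∣ !) ≤ ∣ S ∣ !
∑-children-factorial≤ S = begin
  ∑ (children S) (λ S′ → ∣ S′ ∣ !)
    ≡⟨ ∑-cong (children S) (λ S′∈ → cong (λ k → pred k !) (children-size S S′∈)) ⟩
  ∑ (children S) (λ _ → pred ∣ S ∣ !)  ≡⟨ ∑-const (children S) _ ⟩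
  length (children S) * pred ∣ S ∣ !   ≡⟨ cong (_* pred ∣ S ∣ !) (length-children S) ⟩
  ∣ S ∣ * pred ∣ S ∣ !                 ≤⟨ n*[n∸1]!≤n! ∣ S ∣ ⟩
  ∣ S ∣ !                              ∎
  where
  open ≤-Reasoning
  n*[n∸1]!≤n! : ∀ k → k * pred k ! ≤ k !
  n*[n∸1]!≤n! zero    = z≤n
  n*[n∸1]!≤n! (suc k) = ≤-refl

module _ {n : ℕ} (F : List (Subset n)) where

  open DecMembership (_≟ˢ_ {n}) using (_∈?_)

  -- Incidences (c , A) and (c , A ⊂ B) of the maximal chains c from ∅ to S with members,
  -- respectively pairs of members, of F lying on c.
  membersOnChains pairsTo pairsOnChains : Subset n → ℕ
  membersOnChains S = ∑ F (λ A → ∣ A ∣ ! * chains A S)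
  pairsTo B = ∑ F (λ A → ind (∣ A ∣ <? ∣ B ∣) * (∣ A ∣ ! * chains A B))
  pairsOnChains S = ∑ F (λ B → pairsTo B * chains B S)

  -- On a chain, x members of F span at least x - 1 pairs.  If the top S is in F the pairs
  -- containing S suffice; otherwise every chain passes through a child of S.
  members≤factorial+pairs : Unique F → ∀ k S → ∣ S ∣ ≡ k → membersOnChains S ≤ ∣ S ∣ ! + pairsOnChains S
  members≤factorial+pairs F-unique k S ∣S∣≡k with S ∈? F
  ... | yes S∈F = begin
    membersOnChains S
      -- A member strictly below `S` is charged to its pair with `S`; the set `S` itself, occurring
      -- at most once in `F`, contributes `∣ S ∣ !`.
      ≤⟨ ∑-mono F (λ {A} _ → split A) ⟩
    ∑ F (λ A → ∣ S ∣ ! * ind (A ≟ˢ S) + ind (∣ A ∣ <? ∣ S ∣) * (∣ A ∣ ! * chains A S))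
      ≡⟨ ∑-+ F _ _ ⟩
    ∑ F (λ A → ∣ S ∣ ! * ind (A ≟ˢ S)) + pairsTo S
      ≡⟨ cong (_+ pairsTo S) (∑-*ˡ (∣ S ∣ !) F _) ⟩
    ∣ S ∣ ! * ∑ F (λ A → ind (A ≟ˢ S)) + pairsTo S
      ≤⟨ +-monoˡ-≤ (pairsTo S) (*-monoʳ-≤ (∣ S ∣ !) (∑-ind≤1 _≟ˢ_ (λ eq → eq) F-unique S)) ⟩
    ∣ S ∣ ! * 1 + pairsTo S
      -- As `chains S S` is 1, `pairsTo S` is the term `B = S` of `pairsOnChains S`.
      ≡⟨ cong₂ _+_ (*-identityʳ _) (trans (sym (*-identityʳ _)) (cong (pairsTo S *_) (sym (chains-self S)))) ⟩
    ∣ S ∣ ! + pairsTo S * chains S S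
      ≤⟨ +-monoʳ-≤ (∣ S ∣ !) (∑-term (λ B → pairsTo B * chains B S) S∈F) ⟩
    ∣ S ∣ ! + pairsOnChains S ∎
    where
    open ≤-Reasoning
    split : ∀ A → ∣ A ∣ ! * chains A S ≤ ∣ S ∣ ! * ind (A ≟ˢ S) + ind (∣ A ∣ <? ∣ S ∣) * (∣ A ∣ ! * chains A S)
    split A with inc-dichotomy A S
    ... | inj₁ eq rewrite eq | *-zeroʳ (∣ A ∣ !) = z≤n
    ... | inj₂ (_ , A⊆S) with ∣ A ∣ <? ∣ S ∣
    ...   | yes _ = ≤-trans (≤-reflexive (sym (*-identityˡ _))) (m≤n+m _ (∣ S ∣ ! * ind (A ≟ˢ S)))
    ...   | no ∣A∣≮∣S∣ with ⊆∧∣≥∣⇒≡ A⊆S (≮⇒≥ ∣A∣≮∣S∣)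
    ...     | refl = ≤-trans (≤-reflexive (cong (∣ A ∣ ! *_)
                       (trans (chains-self A) (sym (ind-yes (A ≟ˢ A) refl))))) (m≤m+n _ _)
  ... | no S∉F = begin
    membersOnChains S
      ≡⟨ ∑-cong F (λ {A} A∈ → cong (∣ A ∣ ! *_)
           (∑-children-chains A S (λ { refl → S∉F A∈ }))) ⟨
    ∑ F (λ A → ∣ A ∣ ! * ∑ (children S) (chains A))
      ≡⟨ ∑-cong F (λ {A} _ → ∑-*ˡ (∣ A ∣ !) (children S) (chains A)) ⟨
    ∑ F (λ A → ∑ (children S) (λ S′ → ∣ A ∣ ! * chains A S′))
      ≡⟨ ∑-swap F (children S) _ ⟩
    ∑ (children S) membersOnChains
      ≤⟨ ∑-mono (children S) (below k ∣S∣≡k) ⟩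
    ∑ (children S) (λ S′ → ∣ S′ ∣ ! + pairsOnChains S′)
      ≡⟨ ∑-+ (children S) _ _ ⟩
    ∑ (children S) (λ S′ → ∣ S′ ∣ !) + ∑ (children S) pairsOnChains
      ≤⟨ +-mono-≤ (∑-children-factorial≤ S) ∑-pairs≤ ⟩
    ∣ S ∣ ! + pairsOnChains S ∎
    where
    open ≤-Reasoning
    -- The size `k` is a separate argument to make the recursion structural; at `k = 0` there are no
    -- children.
    below : ∀ k → ∣ S ∣ ≡ k → ∀ {S′} → S′ ∈ children S → membersOnChains S′ ≤ ∣ S′ ∣ ! + pairsOnChains S′
    below zero    eq S′∈ = contradiction (trans (children-size S S′∈) eq) λ ()
    below (suc k) eq {S′} S′∈ =
      members≤factorial+pairs F-unique k S′ (suc-injective (trans (children-size S S′∈) eq))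
    ∑-pairs≤ : ∑ (children S) pairsOnChains ≤ pairsOnChains S
    ∑-pairs≤ = begin
      ∑ (children S) pairsOnChains
        ≡⟨ ∑-swap (children S) F (λ S′ B → pairsTo B * chains B S′) ⟩
      ∑ F (λ B → ∑ (children S) (λ S′ → pairsTo B * chains B S′))
        ≡⟨ ∑-cong F (λ {B} _ → ∑-*ˡ (pairsTo B) (children S) (chains B)) ⟩
      ∑ F (λ B → pairsTo B * ∑ (children S) (chains B))
        ≤⟨ ∑-mono F (λ {B} _ → *-monoʳ-≤ (pairsTo B) (∑-children-chains≤ B S)) ⟩
      pairsOnChains S ∎

-- For `i ≤ n` this is n! / C(n,i), the number of maximal chains through a fixed set of size `i`.
weight : ℕ → ℕ → ℕ
weight n i = i ! * (n ∸ i) !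

-- The number of maximal chains through two fixed nested sets of sizes `i < j`. Without the
-- indicator, truncated subtraction would leave a positive value for `i ≥ j`, and a set would count
-- as paired with itself.
pairWeight : ℕ → ℕ → ℕ → ℕ
pairWeight n i j = ind (i <? j) * (i ! * (j ∸ i) ! * (n ∸ j) !)

-- The case `S = ⊤` of `members≤factorial+pairs`, where `chains A ⊤` is `(n ∸ ∣ A ∣) !`. Divided by
-- n!, it is the LYM inequality with a correction for comparable pairs.
chain-inequality : ∀ {n} {F : List (Subset n)} → Unique F →
  ∑ F (λ A → weight n ∣ A ∣) ≤ n ! + ∑ F (λ A → ∑ F (λ B → inc A B * pairWeight n ∣ A ∣ ∣ B ∣))
chain-inequality {n} {F} u = begin
  ∑ F (λ A → weight n ∣ A ∣)     ≡⟨ ∑-cong F (λ {A} _ → cong (∣ A ∣ ! *_) (sym (chains-⊤ A))) ⟩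
  membersOnChains F ⊤          ≤⟨ members≤factorial+pairs F u n ⊤ (∣⊤∣≡n n) ⟩
  ∣ ⊤ {n} ∣ ! + pairsOnChains F ⊤  ≡⟨ cong₂ _+_ (cong _! (∣⊤∣≡n n)) pairs≡ ⟩
  n ! + ∑ F (λ A → ∑ F (λ B → inc A B * pairWeight n ∣ A ∣ ∣ B ∣)) ∎
  where
  open ≤-Reasoning
  chains-⊤ : ∀ (A : Subset n) → chains A ⊤ ≡ (n ∸ ∣ A ∣) !
  chains-⊤ A rewrite ⊆⇒inc (⊆-max A) | ∣⊤∣≡n n = *-identityˡ _
  shuffle : ∀ a b c d e → (a * (b * (c * d))) * e ≡ c * (a * (b * d * e))
  shuffle = solve-∀
  pairs≡ : pairsOnChains F ⊤ ≡ ∑ F (λ A → ∑ F (λ B → inc A B * pairWeight n ∣ A ∣ ∣ B ∣))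
  pairs≡ = begin-equality
    pairsOnChains F ⊤
      ≡⟨ ∑-cong F (λ {B} _ → cong (pairsTo F B *_) (chains-⊤ B)) ⟩
    ∑ F (λ B → pairsTo F B * (n ∸ ∣ B ∣) !)
      ≡⟨ ∑-cong F (λ {B} _ → ∑-*ʳ ((n ∸ ∣ B ∣) !) F _) ⟨
    ∑ F (λ B → ∑ F (λ A → ind (∣ A ∣ <? ∣ B ∣) * (∣ A ∣ ! * chains A B) * (n ∸ ∣ B ∣) !))
      ≡⟨ ∑-cong F (λ {B} _ → ∑-cong F (λ {A} _ →
           shuffle (ind (∣ A ∣ <? ∣ B ∣)) (∣ A ∣ !) (inc A B) ((∣ B ∣ ∸ ∣ A ∣) !) ((n ∸ ∣ B ∣) !))) ⟩
    ∑ F (λ B → ∑ F (λ A → inc A B * pairWeight n ∣ A ∣ ∣ B ∣))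
      ≡⟨ ∑-swap F F _ ⟩
    ∑ F (λ A → ∑ F (λ B → inc A B * pairWeight n ∣ A ∣ ∣ B ∣)) ∎

inc≤1 : ∀ {n} (A S : Subset n) → inc A S ≤ 1
inc≤1 A S with inc-dichotomy A S
... | inj₁ eq       = ≤-trans (≤-reflexive eq) z≤n
... | inj₂ (eq , _) = ≤-reflexive eq

inc≡1⇒⊆ : ∀ {n} (A S : Subset n) → inc A S ≡ 1 → A ⊆ S
inc≡1⇒⊆ A S eq with inc-dichotomy A S
... | inj₁ eq0      = contradiction (trans (sym eq0) eq) λ ()
... | inj₂ (_ , A⊆) = A⊆

edges : ∀ {n} → List (Subset n) → List (Subset n) → ℕ
edges L U = ∑ L (λ A → ∑ U (inc A))

edges-removeˡ : ∀ {n} (xs {ys} : List (Subset n)) {A} U →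
                edges (xs ++ A ∷ ys) U ≡ ∑ U (inc A) + edges (xs ++ ys) U
edges-removeˡ xs U = ∑-insert xs (λ A → ∑ U (inc A))

edges-removeʳ : ∀ {n} (xs {ys} : List (Subset n)) {B} L →
                edges L (xs ++ B ∷ ys) ≡ ∑ L (λ A → inc A B) + edges L (xs ++ ys)
edges-removeʳ xs {ys} {B} L =
  trans (∑-cong L (λ {A} _ → ∑-insert xs (inc A))) (∑-+ L (λ A → inc A B) _)

-- Binomial coefficients and chain weights

C*weight : ∀ {n k} → k ≤ n → (n C k) * weight n k ≡ n !
C*weight {n} {k} k≤n = trans (cong (_* weight n k) (nCk≡n!/k![n-k]! k≤n)) (m/n*n≡m (k![n∸k]!∣n! k≤n))
  where instance _ = k !* (n ∸ k) !≢0

C-positive : ∀ {n k} → k ≤ n → 1 ≤ n C k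
C-positive {n} {k} k≤n = n≢0⇒n>0 λ C≡0 → n!≢0 (trans (sym (C*weight k≤n)) (cong (_* weight n k) C≡0))
  where
  n!≢0 : n ! ≢ 0
  n!≢0 = ≢-nonZero⁻¹ (n !) {{ n !≢0 }}

C-step : ∀ {n k} → k < n → (n C suc k) * suc k ≡ (n C k) * (n ∸ k)
C-step {n} {k} k<n = *-cancelʳ-≡ _ _ (k ! * (n ∸ suc k) !) (begin
  (n C suc k) * suc k * (k ! * (n ∸ suc k) !)        ≡⟨ assoc (n C suc k) (suc k) (k !) _ ⟩
  (n C suc k) * weight n (suc k)                     ≡⟨ C*weight k<n ⟩
  n !                                              ≡⟨ C*weight (<⇒≤ k<n) ⟨
  (n C k) * (k ! * (n ∸ k) !)                        ≡⟨ cong (λ f → (n C k) * (k ! * f)) unfold ⟩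
  (n C k) * (k ! * ((n ∸ k) * (n ∸ suc k) !))        ≡⟨ assoc′ (n C k) (k !) (n ∸ k) _ ⟩
  (n C k) * (n ∸ k) * (k ! * (n ∸ suc k) !)          ∎)
  where
  open ≡-Reasoning
  instance _ = k !* (n ∸ suc k) !≢0
  unfold : (n ∸ k) ! ≡ (n ∸ k) * (n ∸ suc k) !
  unfold rewrite +-∸-assoc 1 k<n = refl
  assoc : ∀ a b c d → a * b * (c * d) ≡ a * (b * c * d)
  assoc = solve-∀
  assoc′ : ∀ a b c d → a * (b * (c * d)) ≡ a * c * (b * d)
  assoc′ = solve-∀

-- By `C-step` the quotient of consecutive coefficients is (n - k) / (k + 1), which is at least `a`
-- here.
C-ratio : ∀ {n k} a → k < n → a * suc k ≤ n ∸ k → a * (n C k) ≤ n C suc k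
C-ratio {n} {k} a k<n le = *-cancelʳ-≤ _ _ (suc k) (begin
  a * (n C k) * suc k    ≡⟨ shuffle a (n C k) (suc k) ⟩
  (n C k) * (a * suc k)    ≤⟨ *-monoʳ-≤ (n C k) le ⟩
  (n C k) * (n ∸ k)        ≡⟨ C-step k<n ⟨
  (n C suc k) * suc k      ∎)
  where
  open ≤-Reasoning
  shuffle : ∀ a b c → a * b * c ≡ b * (a * c)
  shuffle = solve-∀

-- For a = 1 this is monotonicity up to the middle, for a = 2 geometric growth up to n / 3.
C-growth : ∀ {n} a k s → suc a * (k + s) ≤ n → a ^ s * (n C k) ≤ n C (k + s)
C-growth {n} a k zero    le rewrite +-identityʳ k = ≤-reflexive (*-identityˡ (n C k))
C-growth {n} a k (suc s) le rewrite +-suc k s = begin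
  a * a ^ s * (n C k)    ≡⟨ *-assoc a (a ^ s) _ ⟩
  a * (a ^ s * (n C k))  ≤⟨ *-monoʳ-≤ a (C-growth a k s (≤-trans (*-monoʳ-≤ (suc a) (n≤1+n (k + s))) le)) ⟩
  a * (n C (k + s))      ≤⟨ C-ratio a (≤-trans (m≤m+n _ _) le) (m+n≤o⇒n≤o∸m (k + s) (≤-trans (n≤1+n _) le)) ⟩
  n C suc (k + s)        ∎
  where
  open ≤-Reasoning
  m+n≤o⇒n≤o∸m : ∀ m {n o} → m + n ≤ o → n ≤ o ∸ m
  m+n≤o⇒n≤o∸m m {n} {o} le = m+n≤o⇒m≤o∸n n (≤-trans (≤-reflexive (+-comm n m)) le)

n/2*2≤n : ∀ n → 2 * (n / 2) ≤ n
n/2*2≤n n = ≤-trans (≤-reflexive (*-comm 2 (n / 2))) (m/n*n≤m n 2)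

lower-half≤mid : ∀ n k → k ≤ n / 2 → n C k ≤ midBinom n
lower-half≤mid n k k≤ = begin
  n C k                        ≡⟨ *-identityˡ _ ⟨
  1 * (n C k)                  ≡⟨ cong (_* (n C k)) (^-zeroˡ (n / 2 ∸ k)) ⟨
  1 ^ (n / 2 ∸ k) * (n C k)    ≤⟨ C-growth 1 k (n / 2 ∸ k) (≤-trans (≤-reflexive (cong (2 *_) (m+[n∸m]≡n k≤))) (n/2*2≤n n)) ⟩
  n C (k + (n / 2 ∸ k))        ≡⟨ cong (n C_) (m+[n∸m]≡n k≤) ⟩
  midBinom n                   ∎
  where open ≤-Reasoning

-- Above the middle, the symmetry sending k to n - k reflects into the lower half.
C≤mid : ∀ {n k} → k ≤ n → n C k ≤ midBinom n
C≤mid {n} {k} k≤n with k ≤? n / 2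
... | yes k≤ = lower-half≤mid n k k≤
... | no  k≰ = ≤-trans (≤-reflexive (nCk≡nC[n∸k] k≤n)) (lower-half≤mid n (n ∸ k) n∸k≤)
  where
  n≤ : n ≤ n / 2 + suc (n / 2)
  n≤ = begin
    n                       ≡⟨ m≡m%n+[m/n]*n n 2 ⟩
    n % 2 + n / 2 * 2       ≤⟨ +-monoˡ-≤ _ (s≤s⁻¹ (m%n<n n 2)) ⟩
    1 + n / 2 * 2           ≡⟨ regroup (n / 2) ⟩
    n / 2 + suc (n / 2)     ∎
    where
    open ≤-Reasoning
    regroup : ∀ h → 1 + h * 2 ≡ h + suc h
    regroup = solve-∀
  n∸k≤ : n ∸ k ≤ n / 2
  n∸k≤ = m≤n+o⇒m∸n≤o n k (≤-trans n≤ (≤-trans (+-monoʳ-≤ (n / 2) (≰⇒> k≰)) (≤-reflexive (+-comm (n / 2) k))))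

-- The indices from `k` to `k + q` stay below 2q ≤ n / 3, where each step at least doubles the
-- coefficient; `q` steps gain the factor `2 ^ q`.
C-tail : ∀ {n q k} → 6 * q ≤ n → k ≤ q → 2 ^ q * (n C k) ≤ midBinom n
C-tail {n} {q} {k} 6q≤n k≤q = ≤-trans
  (C-growth 2 k q (≤-trans (≤-trans (*-monoʳ-≤ 3 (+-monoˡ-≤ q k≤q)) (≤-reflexive (six q))) 6q≤n))
  (C≤mid (≤-trans (+-monoˡ-≤ q k≤q) (≤-trans (m≤m+n (q + q) (4 * q)) (≤-trans (≤-reflexive (six′ q)) 6q≤n))))
  where
  six : ∀ q → 3 * (q + q) ≡ 6 * q
  six = solve-∀
  six′ : ∀ q → q + q + 4 * q ≡ 6 * q
  six′ = solve-∀

n≤C : ∀ {n k} → 1 ≤ k → k < n → n ≤ n C k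
n≤C {suc n} {suc zero}    _ _       = ≤-reflexive (sym (nC1≡n (suc n)))
n≤C {suc n} {suc (suc k)} _ (s≤s k<n) = begin
  1 + n                          ≡⟨ +-comm 1 n ⟩
  n + 1                          ≤⟨ +-mono-≤ (n≤C (s≤s z≤n) k<n) (C-positive k<n) ⟩
  n C suc k + n C suc (suc k)    ≡⟨ nCk+nC[k+1]≡[n+1]C[k+1] n (suc k) ⟩
  suc n C suc (suc k)            ∎
  where open ≤-Reasoning

-- Pascal's rule: one summand is quadratic by induction, the other is at least `n` by `n≤C`, and
-- together they cover the growth of n(n - 1) / 2 in one step.
n[n∸1]≤2C : ∀ {n k} → 2 ≤ k → 2 + k ≤ n → n * (n ∸ 1) ≤ 2 * (n C k)
n[n∸1]≤2C {k = suc zero} (s≤s ()) _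
n[n∸1]≤2C {n} {suc (suc zero)} _ 4≤n = ≤-reflexive (begin
  n * (n ∸ 1)      ≡⟨ cong (_* (n ∸ 1)) (nC1≡n n) ⟨
  (n C 1) * (n ∸ 1)  ≡⟨ C-step (≤-trans (s≤s (s≤s z≤n)) 4≤n) ⟨
  (n C 2) * 2        ≡⟨ *-comm (n C 2) 2 ⟩
  2 * (n C 2)      ∎)
  where open ≡-Reasoning
n[n∸1]≤2C {suc n} {suc (suc (suc k))} _ (s≤s le) = begin
  suc n * n                                      ≤⟨ square n ⟩
  n * (n ∸ 1) + 2 * n                            ≤⟨ +-mono-≤ (n[n∸1]≤2C (s≤s (s≤s z≤n)) le) (*-monoʳ-≤ 2 (n≤C (s≤s z≤n) le)) ⟩
  2 * (n C suc (suc k)) + 2 * (n C suc (suc (suc k)))  ≡⟨ *-distribˡ-+ 2 (n C suc (suc k)) _ ⟨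
  2 * (n C suc (suc k) + n C suc (suc (suc k)))  ≡⟨ cong (2 *_) (nCk+nC[k+1]≡[n+1]C[k+1] n (suc (suc k))) ⟩
  2 * (suc n C suc (suc (suc k)))                ∎
  where
  open ≤-Reasoning
  square : ∀ m → suc m * m ≤ m * (m ∸ 1) + 2 * m
  square zero    = z≤n
  square (suc m) = ≤-reflexive (square-suc m)
    where
    square-suc : ∀ m → suc (suc m) * suc m ≡ suc m * m + 2 * suc m
    square-suc = solve-∀

-- An upper bound for p (p + 1) / C(j,i) when 1 ≤ p < i < j, and dually for
-- p (p + 1) / C(n-i,j-i) when i < j < n - p.
γ : ℕ → ℕ → ℕ → ℕ
γ p i j = p * ind (suc i ≟ j) + 2

-- For consecutive sizes the coefficient can be as small as `m`, which is why `γ` has the summand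
-- `p` there. The factor `p * 1 + 2` is what `γ p i j` becomes once `suc i ≟ j` is decided
-- positively.
p[p+1]≤C-near : ∀ {p m k} → suc p ≤ m → 1 ≤ k → k < m → p * suc p ≤ (p * 1 + 2) * (m C k)
p[p+1]≤C-near {p} p<m 1≤k k<m = *-mono-≤ (≤-trans (≤-reflexive (sym (*-identityʳ p))) (m≤m+n _ 2)) (≤-trans p<m (n≤C 1≤k k<m))

-- Two steps away from both ends of the row the coefficient is quadratic in `m`, so the constant 2
-- of `γ` suffices.
p[p+1]≤C-far : ∀ {p m k} → suc p ≤ m → 2 ≤ k → 2 + k ≤ m → p * suc p ≤ (p * 0 + 2) * (m C k)
p[p+1]≤C-far {p} {suc m} {k} (s≤s p≤m) 2≤k 2+k≤m = begin
  p * suc p          ≤⟨ *-mono-≤ p≤m (s≤s p≤m) ⟩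
  m * suc m          ≡⟨ *-comm m (suc m) ⟩
  suc m * m          ≤⟨ n[n∸1]≤2C 2≤k 2+k≤m ⟩
  2 * (suc m C k)    ≡⟨ cong (λ z → (z + 2) * (suc m C k)) (*-zeroʳ p) ⟨
  (p * 0 + 2) * (suc m C k) ∎
  where open ≤-Reasoning

module _ {n p i j : ℕ} (1≤p : 1 ≤ p) (p<i : suc p ≤ i) (i<j : i < j) (j+p<n : j + suc p ≤ n) where

  private
    j≤n : j ≤ n
    j≤n = ≤-trans (m≤m+n j _) j+p<n
    i≤j : i ≤ j
    i≤j = <⇒≤ i<j
    p<n∸j : suc p ≤ n ∸ j
    p<n∸j = m+n≤o⇒m≤o∸n (suc p) (≤-trans (≤-reflexive (+-comm (suc p) j)) j+p<n)
    2≤i : 2 ≤ i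
    2≤i = ≤-trans (s≤s 1≤p) p<i
    split : (j ∸ i) + (n ∸ j) ≡ n ∸ i
    split = +-cancelˡ-≡ i _ _ (begin
      i + ((j ∸ i) + (n ∸ j))  ≡⟨ +-assoc i _ _ ⟨
      i + (j ∸ i) + (n ∸ j)    ≡⟨ cong (_+ (n ∸ j)) (m+[n∸m]≡n i≤j) ⟩
      j + (n ∸ j)              ≡⟨ m+[n∸m]≡n j≤n ⟩
      n                        ≡⟨ m+[n∸m]≡n (≤-trans i≤j j≤n) ⟨
      i + (n ∸ i)              ∎)
      where open ≡-Reasoning
    j∸i≤n∸i : j ∸ i ≤ n ∸ i
    j∸i≤n∸i = ∸-monoˡ-≤ i j≤n
    2+j∸i≤n∸i : 2 + (j ∸ i) ≤ n ∸ i
    2+j∸i≤n∸i = begin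
      2 + (j ∸ i)        ≡⟨ +-comm 2 _ ⟩
      (j ∸ i) + 2        ≤⟨ +-monoʳ-≤ (j ∸ i) (≤-trans (s≤s 1≤p) p<n∸j) ⟩
      (j ∸ i) + (n ∸ j)  ≡⟨ split ⟩
      n ∸ i              ∎
      where open ≤-Reasoning
    p<n∸i : suc p ≤ n ∸ i
    p<n∸i = ≤-trans p<n∸j (≤-trans (m≤n+m _ (j ∸ i)) (≤-reflexive split))

    D≤γC-down : p * suc p ≤ γ p i j * (j C i)
    D≤γC-down with suc i ≟ j
    ... | yes _    = p[p+1]≤C-near (≤-trans p<i i≤j) (≤-trans (s≤s z≤n) 2≤i) i<j
    ... | no  i+1≢j = p[p+1]≤C-far (≤-trans p<i i≤j) 2≤i (≤∧≢⇒< i<j i+1≢j)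

    D≤γC-up : p * suc p ≤ γ p i j * ((n ∸ i) C (j ∸ i))
    D≤γC-up with suc i ≟ j
    ... | yes _    = p[p+1]≤C-near p<n∸i (m<n⇒0<n∸m i<j) (≤-trans (n≤1+n _) 2+j∸i≤n∸i)
    ... | no  i+1≢j = p[p+1]≤C-far p<n∸i (m+n≤o⇒m≤o∸n 2 (≤∧≢⇒< i<j i+1≢j)) 2+j∸i≤n∸i

    pairWeight≡ : pairWeight n i j ≡ i ! * (j ∸ i) ! * (n ∸ j) !
    pairWeight≡ = trans (cong (_* (i ! * (j ∸ i) ! * (n ∸ j) !)) (ind-yes (i <? j) i<j)) (*-identityˡ _)

  -- A chain through a set of size `j` meets one of its C(j,i) subsets of size `i`, so
  -- `pairWeight n i j` is `weight n j` divided by C(j,i), and C(j,i) is large by `D≤γC-down`.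
  pairWeight≤weight-upper : p * suc p * pairWeight n i j ≤ γ p i j * weight n j
  pairWeight≤weight-upper = begin
    p * suc p * pairWeight n i j
      ≤⟨ *-monoˡ-≤ _ D≤γC-down ⟩
    γ p i j * (j C i) * pairWeight n i j
      ≡⟨ cong (γ p i j * (j C i) *_) pairWeight≡ ⟩
    γ p i j * (j C i) * (i ! * (j ∸ i) ! * (n ∸ j) !)
      ≡⟨ shuffle (γ p i j) (j C i) (i !) ((j ∸ i) !) ((n ∸ j) !) ⟩
    γ p i j * ((j C i) * weight j i * (n ∸ j) !)
      ≡⟨ cong (λ x → γ p i j * (x * (n ∸ j) !)) (C*weight i≤j) ⟩
    γ p i j * weight n j ∎
    where
    open ≤-Reasoning
    shuffle : ∀ a b c d e → a * b * (c * d * e) ≡ a * (b * (c * d) * e)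
    shuffle = solve-∀

  -- Dually, a set of size `i` has C(n-i,j-i) supersets of size `j`, so `pairWeight n i j` is
  -- `weight n i` divided by that number.
  pairWeight≤weight-lower : p * suc p * pairWeight n i j ≤ γ p i j * weight n i
  pairWeight≤weight-lower = begin
    p * suc p * pairWeight n i j
      ≤⟨ *-monoˡ-≤ _ D≤γC-up ⟩
    γ p i j * ((n ∸ i) C (j ∸ i)) * pairWeight n i j
      ≡⟨ cong (γ p i j * ((n ∸ i) C (j ∸ i)) *_) pairWeight≡ ⟩
    γ p i j * ((n ∸ i) C (j ∸ i)) * (i ! * (j ∸ i) ! * (n ∸ j) !)
      ≡⟨ shuffle (γ p i j) ((n ∸ i) C (j ∸ i)) (i !) ((j ∸ i) !) ((n ∸ j) !) ⟩
    γ p i j * (i ! * (((n ∸ i) C (j ∸ i)) * ((j ∸ i) ! * (n ∸ j) !)))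
      ≡⟨ cong (λ k → γ p i j * (i ! * (((n ∸ i) C (j ∸ i)) * ((j ∸ i) ! * k !)))) n∸j≡ ⟩
    γ p i j * (i ! * (((n ∸ i) C (j ∸ i)) * weight (n ∸ i) (j ∸ i)))
      ≡⟨ cong (λ x → γ p i j * (i ! * x)) (C*weight j∸i≤n∸i) ⟩
    γ p i j * weight n i ∎
    where
    open ≤-Reasoning
    n∸j≡ : n ∸ j ≡ (n ∸ i) ∸ (j ∸ i)
    n∸j≡ = sym (trans (cong (_∸ (j ∸ i)) (sym split)) (m+n∸m≡n (j ∸ i) (n ∸ j)))
    shuffle : ∀ a b c d e → a * b * (c * d * e) ≡ a * (c * (b * (d * e)))
    shuffle = solve-∀

-- Layers

layer : (n k : ℕ) → List (Subset n)
layer zero    zero    = [] ∷ []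
layer zero    (suc k) = []
layer (suc n) zero    = map (false ∷_) (layer n zero)
layer (suc n) (suc k) = map (true ∷_) (layer n k) ++ map (false ∷_) (layer n (suc k))

length-layer : ∀ n k → length (layer n k) ≡ n C k
length-layer zero    zero    = refl
length-layer zero    (suc k) = refl
length-layer (suc n) zero    = trans (length-map _ (layer n zero)) (length-layer n zero)
length-layer (suc n) (suc k) = begin
  length (layer (suc n) (suc k))
    ≡⟨ length-++ (map (true ∷_) (layer n k)) ⟩
  length (map (true ∷_) (layer n k)) + length (map (false ∷_) (layer n (suc k)))
    ≡⟨ cong₂ _+_ (length-map _ (layer n k)) (length-map _ (layer n (suc k))) ⟩
  length (layer n k) + length (layer n (suc k))
    ≡⟨ cong₂ _+_ (length-layer n k) (length-layer n (suc k)) ⟩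
  n C k + n C suc k
    ≡⟨ nCk+nC[k+1]≡[n+1]C[k+1] n k ⟩
  suc n C suc k ∎
  where open ≡-Reasoning

layer-size : ∀ n k {A} → A ∈ layer n k → ∣ A ∣ ≡ k
layer-size zero    zero    (here refl) = refl
layer-size (suc n) zero    A∈ with ∈-map⁻ (false ∷_) A∈
... | _ , p , refl = layer-size n zero p
layer-size (suc n) (suc k) A∈ with ∈-++⁻ (map (true ∷_) (layer n k)) A∈
... | inj₁ A∈₁ with ∈-map⁻ (true ∷_) A∈₁
...   | _ , p , refl = cong suc (layer-size n k p)
layer-size (suc n) (suc k) A∈ | inj₂ A∈₂ with ∈-map⁻ (false ∷_) A∈₂
...   | _ , p , refl = layer-size n (suc k) p

∈-layer : ∀ {n} (A : Subset n) {k} → ∣ A ∣ ≡ k → A ∈ layer n k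
∈-layer []          {zero}  eq = here refl
∈-layer (true ∷ A)  {suc k} eq = ∈-++⁺ˡ (∈-map⁺ (true ∷_) (∈-layer A (suc-injective eq)))
∈-layer (false ∷ A) {zero}  eq = ∈-map⁺ (false ∷_) (∈-layer A eq)
∈-layer (false ∷ A) {suc k} eq = ∈-++⁺ʳ (map (true ∷_) (layer _ k)) (∈-map⁺ (false ∷_) (∈-layer A eq))

layer-unique : ∀ n k → Unique (layer n k)
layer-unique zero    zero    = [] ∷ []
layer-unique zero    (suc k) = []
layer-unique (suc n) zero    = Unique.map⁺ ∷-injectiveʳ (layer-unique n zero)
layer-unique (suc n) (suc k) =
  Unique.++⁺ (Unique.map⁺ ∷-injectiveʳ (layer-unique n k)) (Unique.map⁺ ∷-injectiveʳ (layer-unique n (suc k))) disjoint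
  where
  disjoint : ∀ {A} → ¬ (A ∈ map (true ∷_) (layer n k) × A ∈ map (false ∷_) (layer n (suc k)))
  disjoint (A∈₁ , A∈₂) with ∈-map⁻ (true ∷_) A∈₁ | ∈-map⁻ (false ∷_) A∈₂
  ... | _ , _ , refl | _ , _ , ()

-- The layers near the bottom and the top

length-concatMap : (f : A → List B) (xs : List A) → length (concatMap f xs) ≡ ∑ xs (length ∘ f)
length-concatMap f []       = refl
length-concatMap f (x ∷ xs) = trans (length-++ (f x)) (cong (length (f x) +_) (length-concatMap f xs))

Central : ∀ {n} → ℕ → Subset n → Set
Central {n} q A = q ≤ ∣ A ∣ × ∣ A ∣ + q ≤ n

central? : ∀ {n} q (A : Subset n) → Dec (Central q A)
central? {n} q A = (q ≤? ∣ A ∣) ×-dec (∣ A ∣ + q ≤? n)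

-- A non-central set has size `k` or `n ∸ k` for some `k < q`, and by `C-tail` each of these layers
-- is smaller than the middle one by a factor `2 ^ q`.
outer-bound : ∀ {n q} {G : List (Subset n)} → 6 * q ≤ n → Unique G → (∀ {A} → A ∈ G → ¬ Central q A) →
              2 ^ q * length G ≤ q * (2 * midBinom n)
outer-bound {n} {q} {G} 6q≤n G-unique outer = begin
  2 ^ q * length G
    ≤⟨ *-monoʳ-≤ (2 ^ q) (unique-⊆-length G-unique (λ {A} A∈ → ∈-concatMap⁺ two-layers (located A (outer A∈)))) ⟩
  2 ^ q * length (concatMap two-layers (upTo q))
    ≡⟨ cong (2 ^ q *_) (length-concatMap two-layers (upTo q)) ⟩
  2 ^ q * ∑ (upTo q) (length ∘ two-layers)
    ≡⟨ ∑-*ˡ (2 ^ q) (upTo q) _ ⟨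
  ∑ (upTo q) (λ k → 2 ^ q * length (two-layers k))
    ≤⟨ ∑-mono (upTo q) (λ k∈ → two-layers-bound (<⇒≤ (∈-upTo⁻ k∈))) ⟩
  ∑ (upTo q) (λ _ → 2 * midBinom n)
    ≡⟨ ∑-const (upTo q) _ ⟩
  length (upTo q) * (2 * midBinom n)
    ≡⟨ cong (_* (2 * midBinom n)) (length-upTo q) ⟩
  q * (2 * midBinom n) ∎
  where
  open ≤-Reasoning
  two-layers : ℕ → List (Subset n)
  two-layers k = layer n k ++ layer n (n ∸ k)
  q≤n : q ≤ n
  q≤n = ≤-trans (m≤m+n q _) 6q≤n
  located : ∀ A → ¬ Central q A → Any ((A ∈_) ∘ two-layers) (upTo q)
  located A ¬central with q ≤? ∣ A ∣
  ... | no  q≰ = lose (∈-upTo⁺ (≰⇒> q≰)) (∈-++⁺ˡ (∈-layer A refl))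
  ... | yes q≤ = lose (∈-upTo⁺ n∸∣A∣<q) (∈-++⁺ʳ (layer n (n ∸ ∣ A ∣)) (∈-layer A (sym (m∸[m∸n]≡n (∣p∣≤n A)))))
    where
    n∸∣A∣<q : n ∸ ∣ A ∣ < q
    n∸∣A∣<q = <-≤-trans (∸-monoˡ-< (≰⇒> (λ le → ¬central (q≤ , le))) (∣p∣≤n A)) (≤-reflexive (m+n∸m≡n ∣ A ∣ q))
  two-layers-bound : ∀ {k} → k ≤ q → 2 ^ q * length (two-layers k) ≤ 2 * midBinom n
  two-layers-bound {k} k≤q = begin
    2 ^ q * length (two-layers k)
      ≡⟨ cong (2 ^ q *_) (trans (length-++ (layer n k)) (cong₂ _+_ (length-layer n k) (trans (length-layer n (n ∸ k)) (sym (nCk≡nC[n∸k] (≤-trans k≤q q≤n)))))) ⟩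
    2 ^ q * (n C k + n C k)  ≡⟨ double (2 ^ q) (n C k) ⟩
    2 * (2 ^ q * (n C k))    ≤⟨ *-monoʳ-≤ 2 (C-tail 6q≤n k≤q) ⟩
    2 * midBinom n           ∎
    where
    double : ∀ x c → x * (c + c) ≡ 2 * (x * c)
    double = solve-∀

-- Sorting sums by set size

∑-filter : (h : A → ℕ) (i : ℕ) (xs : List A) (g : A → ℕ) →
           ∑ (filter (λ x → i ≟ h x) xs) g ≡ ∑ xs (λ x → ind (i ≟ h x) * g x)
∑-filter h i []       g = refl
∑-filter h i (x ∷ xs) g with i ≟ h x
... | yes eq rewrite filter-accept (λ x → i ≟ h x) {xs = xs} eq =
        cong₂ _+_ (sym (*-identityˡ (g x))) (∑-filter h i xs g)
... | no neq rewrite filter-reject (λ x → i ≟ h x) {xs = xs} neq =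
        ∑-filter h i xs g

-- The value `h x` occurs exactly once in `upTo (suc n)`, so exchanging the two sums gives back
-- `∑ xs g`.
∑-fibres : (h : A → ℕ) (n : ℕ) → (∀ x → h x ≤ n) → (xs : List A) (g : A → ℕ) →
           ∑ xs g ≡ ∑ (upTo (suc n)) (λ i → ∑ (filter (λ x → i ≟ h x) xs) g)
∑-fibres h n h≤n xs g = sym (begin
  ∑ (upTo (suc n)) (λ i → ∑ (filter (λ x → i ≟ h x) xs) g)
    ≡⟨ ∑-cong (upTo (suc n)) (λ {i} _ → ∑-filter h i xs g) ⟩
  ∑ (upTo (suc n)) (λ i → ∑ xs (λ x → ind (i ≟ h x) * g x))
    ≡⟨ ∑-swap (upTo (suc n)) xs _ ⟩
  ∑ xs (λ x → ∑ (upTo (suc n)) (λ i → ind (i ≟ h x) * g x))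
    ≡⟨ ∑-cong xs (λ {x} _ → trans (∑-*ʳ (g x) (upTo (suc n)) (λ i → ind (i ≟ h x)))
         (trans (cong (_* g x) (once x)) (*-identityˡ (g x)))) ⟩
  ∑ xs g ∎)
  where
  open ≡-Reasoning
  once : ∀ x → ∑ (upTo (suc n)) (λ i → ind (i ≟ h x)) ≡ 1
  once x = ≤-antisym (∑-ind≤1 _≟_ (λ eq → eq) (Unique.upTo⁺ (suc n)) (h x))
    (≤-trans (≤-reflexive (sym (ind-yes (h x ≟ h x) refl)))
             (∑-term (λ i → ind (i ≟ h x)) (∈-upTo⁺ (s≤s (h≤n x)))))

-- The summand `p` appears for at most one `i`, namely the predecessor of `j`. So a whole row of
-- coefficients of order `p * suc p` in the denominator costs only O(p + n) in the numerator.
∑-γ-lower : ∀ p n j → ∑ (upTo n) (λ i → γ p i j) ≤ p + 2 * n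
∑-γ-lower p n j = begin
  ∑ (upTo n) (λ i → p * ind (suc i ≟ j) + 2)
    ≡⟨ ∑-+ (upTo n) _ _ ⟩
  ∑ (upTo n) (λ i → p * ind (suc i ≟ j)) + ∑ (upTo n) (λ _ → 2)
    ≡⟨ cong₂ _+_ (∑-*ˡ p (upTo n) _) (trans (∑-const (upTo n) 2) (trans (cong (_* 2) (length-upTo n)) (*-comm n 2))) ⟩
  p * ∑ (upTo n) (λ i → ind (suc i ≟ j)) + 2 * n
    ≤⟨ +-monoˡ-≤ (2 * n) (*-monoʳ-≤ p (∑-ind≤1 _≟_ suc-injective (Unique.upTo⁺ n) j)) ⟩
  p * 1 + 2 * n
    ≡⟨ cong (_+ 2 * n) (*-identityʳ p) ⟩
  p + 2 * n ∎
  where open ≤-Reasoning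

ind-sym : ∀ a b → ind (a ≟ b) ≡ ind (b ≟ a)
ind-sym a b with a ≟ b
... | yes eq = sym (ind-yes (b ≟ a) (sym eq))
... | no neq = sym (ind-no (b ≟ a) (neq ∘ sym))

∑-γ-upper : ∀ p n i → ∑ (upTo n) (γ p i) ≤ p + 2 * n
∑-γ-upper p n i = begin
  ∑ (upTo n) (λ j → p * ind (suc i ≟ j) + 2)
    ≡⟨ ∑-+ (upTo n) _ _ ⟩
  ∑ (upTo n) (λ j → p * ind (suc i ≟ j)) + ∑ (upTo n) (λ _ → 2)
    ≡⟨ cong₂ _+_ (∑-*ˡ p (upTo n) _) (trans (∑-const (upTo n) 2) (trans (cong (_* 2) (length-upTo n)) (*-comm n 2))) ⟩
  p * ∑ (upTo n) (λ j → ind (suc i ≟ j)) + 2 * n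
    ≡⟨ cong (λ s → p * s + 2 * n) (∑-cong (upTo n) (λ {j} _ → ind-sym (suc i) j)) ⟩
  p * ∑ (upTo n) (λ j → ind (j ≟ suc i)) + 2 * n
    ≤⟨ +-monoˡ-≤ (2 * n) (*-monoʳ-≤ p (∑-ind≤1 _≟_ (λ eq → eq) (Unique.upTo⁺ n) (suc i))) ⟩
  p * 1 + 2 * n
    ≡⟨ cong (_+ 2 * n) (*-identityʳ p) ⟩
  p + 2 * n ∎
  where open ≤-Reasoning

-- In the second case the members of both lists let `block-bound` read off the central range of `i`
-- and `j`.
edges-empty : ∀ {n} (L U : List (Subset n)) → edges L U ≡ 0 ⊎ (∃ (_∈ L) × ∃ (_∈ U))
edges-empty []      U       = inj₁ refl
edges-empty (A ∷ L) []      = inj₁ (∑-zero (A ∷ L) (λ _ → refl))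
edges-empty (A ∷ L) (B ∷ U) = inj₂ ((A , here refl) , (B , here refl))

-- Numerical estimates

q²≤2^q : ∀ {q} → 4 ≤ q → q * q ≤ 2 ^ q
q²≤2^q 4≤q = subst (λ q → q * q ≤ 2 ^ q) (m+[n∸m]≡n 4≤q) (from4 _)
  where
  open ≤-Reasoning
  expand : ∀ k → (5 + k) * (5 + k) + (k * k + 6 * k + 7) ≡ 2 * ((4 + k) * (4 + k))
  expand = solve-∀
  from4 : ∀ k → (4 + k) * (4 + k) ≤ 2 ^ (4 + k)
  -- Both sides are 16 at q = 4.
  from4 zero    = ≤-refl
  from4 (suc k) = begin
    (4 + suc k) * (4 + suc k)                    ≡⟨ cong (λ x → x * x) (+-suc 4 k) ⟩
    (5 + k) * (5 + k)                            ≤⟨ m≤m+n _ _ ⟩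
    (5 + k) * (5 + k) + (k * k + 6 * k + 7)      ≡⟨ expand k ⟩
    2 * ((4 + k) * (4 + k))                      ≤⟨ *-monoʳ-≤ 2 (from4 k) ⟩
    2 * 2 ^ (4 + k)                              ≡⟨ cong (2 ^_) (+-suc 4 k) ⟨
    2 ^ (4 + suc k)                              ∎

-- A bootstrap. Cancelling `suc p` leaves pW ≤ pf + 50tW. As 50t ≤ p / 2, this first gives the crude
-- bound W ≤ 2f, and inserting that into the error term gives the sharp one. It is applied with `W`
-- the total chain weight, `f` = n! and `t` the size of the tree.
absorb : ∀ {p t W f Γ} → 1 ≤ p → 100 * t ≤ p → Γ ≤ 25 * suc p →
         p * suc p * W ≤ p * suc p * f + t * (2 * (Γ * W)) → p * W ≤ (p + 100 * t) * f
absorb {p} {t} {W} {f} {Γ} 1≤p 100t≤p Γ≤ ineq = begin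
  p * W                    ≤⟨ pW≤ ⟩
  p * f + 50 * t * W       ≤⟨ +-monoʳ-≤ (p * f) (*-monoʳ-≤ (50 * t) W≤2f) ⟩
  p * f + 50 * t * (2 * f) ≡⟨ collect p t f ⟩
  (p + 100 * t) * f        ∎
  where
  open ≤-Reasoning
  instance _ = >-nonZero 1≤p
  collect : ∀ p t f → p * f + 50 * t * (2 * f) ≡ (p + 100 * t) * f
  collect = solve-∀
  factor : ∀ p q t W f → p * q * f + t * (2 * (25 * q * W)) ≡ q * (p * f + 50 * t * W)
  factor = solve-∀
  factor′ : ∀ p q W → q * (p * W) ≡ p * q * W
  factor′ = solve-∀
  double : ∀ p t W f → 2 * (p * f + 50 * t * W) ≡ p * (2 * f) + 100 * t * W
  double = solve-∀
  pW≤ : p * W ≤ p * f + 50 * t * W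
  pW≤ = *-cancelˡ-≤ (suc p) (begin
    suc p * (p * W)                                      ≡⟨ factor′ p (suc p) W ⟩
    p * suc p * W                                        ≤⟨ ineq ⟩
    p * suc p * f + t * (2 * (Γ * W))                    ≤⟨ +-monoʳ-≤ (p * suc p * f) (*-monoʳ-≤ t (*-monoʳ-≤ 2 (*-monoˡ-≤ W Γ≤))) ⟩
    p * suc p * f + t * (2 * (25 * suc p * W))           ≡⟨ factor p (suc p) t W f ⟩
    suc p * (p * f + 50 * t * W)                         ∎)
  W≤2f : W ≤ 2 * f
  W≤2f = *-cancelˡ-≤ p (+-cancelʳ-≤ (p * W) _ _ (begin
    p * W + p * W                  ≡⟨ cong (p * W +_) (+-identityʳ _) ⟨
    2 * (p * W)                    ≤⟨ *-monoʳ-≤ 2 pW≤ ⟩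
    2 * (p * f + 50 * t * W)       ≡⟨ double p t W f ⟩
    p * (2 * f) + 100 * t * W      ≤⟨ +-monoʳ-≤ (p * (2 * f)) (*-monoˡ-≤ W 100t≤p) ⟩
    p * (2 * f) + p * W            ∎))

-- Tree posets of height 2

module HeightTwoTree (T : FinPoset) (connected : HasseConnected T)
                     (acyclic : ¬ HasseHasCycle T) (height2 : HeightIs T 2) where

  open FinPoset T
  open IsPartialOrder isPartialOrder using (antisym) renaming (trans to ≼-trans)
  open DecMembership (Fin._≟_ {size}) using (_∈?_)

  no-3-chain : ∀ {x y z} → _≺_ T x y → _≺_ T y z → ⊥
  no-3-chain {x} {y} {z} (x≼y , x≢y) (y≼z , y≢z) = <⇒≱ (n<1+n 2) (proj₂ height2 (x ∷ y ∷ z ∷ [])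
    ( ((x≢y ∷ x≢z ∷ []) ∷ (y≢z ∷ []) ∷ [] ∷ [])
    , ((inj₁ x≼y ∷ inj₁ (≼-trans x≼y y≼z) ∷ []) ∷ (inj₁ y≼z ∷ []) ∷ [] ∷ [])))
    where
    x≢z : x ≢ z
    x≢z refl = x≢y (antisym x≼y y≼z)

  ≺⇒Covers : ∀ {x y} → _≺_ T x y → Covers T x y
  ≺⇒Covers x≺y = x≺y , λ z (x≺z , z≺y) → no-3-chain x≺z z≺y

  edge : ∃ λ a → ∃ λ b → Covers T a b
  edge with proj₁ height2
  ... | a ∷ b ∷ [] , (((a≢b ∷ []) ∷ _) , ((inj₁ a≼b ∷ []) ∷ _)) , refl = a , b , ≺⇒Covers (a≼b , a≢b)
  ... | a ∷ b ∷ [] , (((a≢b ∷ []) ∷ _) , ((inj₂ b≼a ∷ []) ∷ _)) , refl = b , a , ≺⇒Covers (b≼a , a≢b ∘ sym)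

  Lower Upper : Elt T → Set
  Lower x = ∃ λ y → Covers T x y
  Upper y = ∃ λ x → Covers T x y

  Lower∧Upper⇒⊥ : ∀ {x} → Lower x → Upper x → ⊥
  Lower∧Upper⇒⊥ (_ , x⋖y , _) (_ , w⋖x , _) = no-3-chain w⋖x x⋖y

  -- No element is isolated: the first step of a walk to an endpoint of `edge` shows on which side
  -- `x` lies.
  side : ∀ x → Lower x ⊎ Upper x
  side x with edge
  ... | a , b , a⋖b with x Fin.≟ a
  ...   | yes refl = inj₁ (b , a⋖b)
  ...   | no x≢a with connected x a
  ...     | here              = contradiction refl x≢a
  ...     | step (inj₁ x⋖y) _ = inj₁ (_ , x⋖y)
  ...     | step (inj₂ y⋖x) _ = inj₂ (_ , y⋖x)

  rank : Elt T → ℕ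
  rank x = [ (λ _ → 0) , (λ _ → 1) ]′ (side x)

  rank-lower : ∀ {x} → Lower x → rank x ≡ 0
  rank-lower {x} lo with side x
  ... | inj₁ _  = refl
  ... | inj₂ up = contradiction up (Lower∧Upper⇒⊥ lo)

  rank-upper : ∀ {x} → Upper x → rank x ≡ 1
  rank-upper {x} up with side x
  ... | inj₁ lo = contradiction up (Lower∧Upper⇒⊥ lo)
  ... | inj₂ _  = refl

  rank-isRankFunction : IsRankFunction T rank
  rank-isRankFunction x y x⋖y = trans (rank-upper (x , x⋖y)) (cong suc (sym (rank-lower (y , x⋖y))))

  -- Simple paths in the Hasse diagram

  data Path : Elt T → Elt T → List (Elt T) → Set where
    [-] : ∀ {x} → Path x x (x ∷ [])
    _∷_ : ∀ {x y z ws} → HasseAdj T x y → Path y z ws → Path x z (x ∷ ws)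

  -- With `z = v` this is the closed list of vertices that `HasseHasCycle` asks for.
  path-linked : ∀ {v x y z ws} → HasseAdj T v x → Path x y ws → HasseAdj T y z →
                Linked (HasseAdj T) (v ∷ ws ++ [ z ])
  path-linked vx [-]      yz = vx ∷ yz ∷ [-]
  path-linked vx (xw ∷ p) yz = vx ∷ path-linked xw p yz

  path-snoc : ∀ {x y z ws} → Path x y ws → HasseAdj T y z → Path x z (ws ++ [ z ])
  path-snoc [-]      yz = yz ∷ [-]
  path-snoc (xw ∷ p) yz = xw ∷ path-snoc p yz

  path-length : ∀ {x y ws} → Path x y ws → x ≢ y → 2 ≤ length ws
  path-length [-]           x≢y = contradiction refl x≢y
  path-length (_ ∷ [-])     _   = s≤s (s≤s z≤n)
  path-length (_ ∷ (_ ∷ _)) _   = s≤s (s≤s z≤n)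

  ∉⇒Unique-∷ : ∀ {v : Elt T} {ws} → v ∉ ws → Unique ws → Unique (v ∷ ws)
  ∉⇒Unique-∷ v∉ u = All.¬Any⇒All¬ _ v∉ ∷ u

  SimplePathIn : List (Elt T) → Elt T → Elt T → Set
  SimplePathIn V x y = ∃ λ ws → Path x y ws × Unique ws × (∀ {z} → z ∈ ws → z ∈ V)

  -- Greedy embedding of the tree between two levels

  module Embed {n : ℕ} (L U : List (Subset n))
    (up   : ∀ {A} → A ∈ L → ∀ used → length used ≤ size → ∃ λ B → B ∈ U × A ⊆ B × B ∉ used)
    (down : ∀ {B} → B ∈ U → ∀ used → length used ≤ size → ∃ λ A → A ∈ L × A ⊆ B × A ∉ used)
    where

    -- The map `φ` is total, but only its values on `dom` count. The field `dom-conn` keeps the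
    -- placed part connected within itself; acyclicity can then be used against a new vertex with
    -- two placed neighbours.
    record PartialCopy : Set where
      field
        dom        : List (Elt T)
        dom-unique : Unique dom
        dom-conn   : ∀ {x y} → x ∈ dom → y ∈ dom → SimplePathIn dom x y
        φ          : Elt T → Subset n
        φ-inj      : ∀ {x y} → x ∈ dom → y ∈ dom → φ x ≡ φ y → x ≡ y
        φ-lower    : ∀ {x} → x ∈ dom → Lower x → φ x ∈ L
        φ-upper    : ∀ {x} → x ∈ dom → Upper x → φ x ∈ U
        φ-mono     : ∀ {x y} → x ∈ dom → y ∈ dom → Covers T x y → φ x ⊆ φ y

    open PartialCopy

    Extends : PartialCopy → PartialCopy → Set
    Extends p q = ∀ {x} → x ∈ dom p → x ∈ dom q

    module _ (p : PartialCopy) {u v : Elt T} (u∈ : u ∈ dom p) (v∉ : v ∉ dom p) (uv : HasseAdj T u v) where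

      -- A second placed neighbour would be joined to `u` by a simple path inside `dom p`, which
      -- together with `v` outside it closes a cycle.
      only-neighbour : ∀ {x} → x ∈ dom p → HasseAdj T x v → x ≡ u
      only-neighbour {x} x∈ xv with x Fin.≟ u
      ... | yes x≡u = x≡u
      ... | no  x≢u with dom-conn p u∈ x∈
      ...   | ws , path , ws-unique , ws⊆ = contradiction
                (v , ws , path-length path (x≢u ∘ sym) , ∉⇒Unique-∷ (v∉ ∘ ws⊆) ws-unique
                   , path-linked (swap uv) path xv)
                acyclic

      used : List (Subset n)
      used = map (φ p) (dom p)

      ∣used∣≤size : length used ≤ size
      ∣used∣≤size = begin
        length used           ≡⟨ length-map (φ p) (dom p) ⟩
        length (dom p)        ≤⟨ unique-⊆-length (dom-unique p) (λ {x} _ → ∈-allFin x) ⟩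
        length (allFin size)  ≡⟨ length-tabulate {n = size} (λ i → i) ⟩
        size                  ∎
        where open ≤-Reasoning

      -- Each requirement is conditional on the position of `v`, so that a single extension serves
      -- whether `v` lies above or below `u`.
      Admissible : Subset n → Set
      Admissible B = B ∉ used × (Lower v → B ∈ L) × (Upper v → B ∈ U)
                   × (Covers T u v → φ p u ⊆ B) × (Covers T v u → B ⊆ φ p u)

      image : ∃ Admissible
      image = choose uv
        where
        choose : HasseAdj T u v → ∃ Admissible
        choose (inj₁ u⋖v) with up (φ-lower p u∈ (v , u⋖v)) used ∣used∣≤size
        ... | B , B∈ , u⊆B , B∉ = B , B∉ , (λ lo → contradiction (u , u⋖v) (Lower∧Upper⇒⊥ lo)) , (λ _ → B∈)
              , (λ _ → u⊆B) , (λ v⋖u → contradiction (u , u⋖v) (Lower∧Upper⇒⊥ (u , v⋖u)))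
        choose (inj₂ v⋖u) with down (φ-upper p u∈ (v , v⋖u)) used ∣used∣≤size
        ... | B , B∈ , B⊆u , B∉ = B , B∉ , (λ _ → B∈) , (λ up → contradiction up (Lower∧Upper⇒⊥ (u , v⋖u)))
              , (λ u⋖v → contradiction (u , u⋖v) (Lower∧Upper⇒⊥ (u , v⋖u))) , (λ _ → B⊆u)

      B₀ : Subset n
      B₀ = proj₁ image

      φ′ : Elt T → Subset n
      φ′ x = if does (x Fin.≟ v) then B₀ else φ p x

      φ′-new : φ′ v ≡ B₀
      φ′-new with v Fin.≟ v
      ... | yes _  = refl
      ... | no v≢v = contradiction refl v≢v

      φ′-old : ∀ {x} → x ∈ dom p → φ′ x ≡ φ p x
      φ′-old {x} x∈ with x Fin.≟ v
      ... | yes refl = contradiction x∈ v∉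
      ... | no _     = refl

      extend : ∃ λ q → v ∈ dom q × Extends p q
      extend with image in image≡
      -- The equation `image≡` is kept because `φ′` refers to the image through `B₀`.
      ... | B , B∉ , B∈L , B∈U , u⊆B , B⊆u = q , here refl , there
        where
        new : φ′ v ≡ B
        new = trans φ′-new (cong proj₁ image≡)
        B≢old : ∀ {x} → x ∈ dom p → φ′ v ≢ φ′ x
        B≢old x∈ eq = B∉ (subst (_∈ used) (trans (sym (φ′-old x∈)) (trans (sym eq) new)) (∈-map⁺ (φ p) x∈))
        simple-path-to-v : ∀ {x} → x ∈ dom p → SimplePathIn (v ∷ dom p) x v
        simple-path-to-v x∈ with dom-conn p x∈ u∈
        ... | ws , path , ws-unique , ws⊆ = ws ++ [ v ] , path-snoc path uv
            , Unique.++⁺ ws-unique ([] ∷ []) (λ { (z∈ , here refl) → v∉ (ws⊆ z∈) })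
            , λ z∈ → [ there ∘ ws⊆ , (λ { (here refl) → here refl }) ]′ (∈-++⁻ ws z∈)
        simple-path-from-v : ∀ {x} → x ∈ dom p → SimplePathIn (v ∷ dom p) v x
        simple-path-from-v x∈ with dom-conn p u∈ x∈
        ... | ws , path , ws-unique , ws⊆ = v ∷ ws , (swap uv ∷ path)
            , ∉⇒Unique-∷ (v∉ ∘ ws⊆) ws-unique
            , λ { (here refl) → here refl ; (there z∈) → there (ws⊆ z∈) }
        q : PartialCopy
        q .dom = v ∷ dom p
        q .dom-unique = ∉⇒Unique-∷ v∉ (dom-unique p)
        q .dom-conn (here refl) (here refl) = v ∷ [] , [-] , ([] ∷ []) , λ { (here refl) → here refl }
        q .dom-conn (here refl) (there y∈)  = simple-path-from-v y∈
        q .dom-conn (there x∈)  (here refl) = simple-path-to-v x∈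
        q .dom-conn (there x∈)  (there y∈)  with dom-conn p x∈ y∈
        ... | ws , path , ws-unique , ws⊆ = ws , path , ws-unique , there ∘ ws⊆
        q .φ = φ′
        q .φ-inj (here refl) (here refl) _  = refl
        q .φ-inj (here refl) (there y∈)  eq = contradiction eq (B≢old y∈)
        q .φ-inj (there x∈)  (here refl) eq = contradiction (sym eq) (B≢old x∈)
        q .φ-inj (there x∈)  (there y∈)  eq =
          φ-inj p x∈ y∈ (trans (sym (φ′-old x∈)) (trans eq (φ′-old y∈)))
        q .φ-lower (here refl) lo = subst (_∈ L) (sym new) (B∈L lo)
        q .φ-lower (there x∈)  lo = subst (_∈ L) (sym (φ′-old x∈)) (φ-lower p x∈ lo)
        q .φ-upper (here refl) hi = subst (_∈ U) (sym new) (B∈U hi)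
        q .φ-upper (there x∈)  hi = subst (_∈ U) (sym (φ′-old x∈)) (φ-upper p x∈ hi)
        q .φ-mono (here refl) (here refl) _   = λ z∈ → z∈
        -- The only placed neighbour of `v` is `u`, for which admissibility gives the inclusion.
        q .φ-mono (here refl) (there y∈)  v⋖y with only-neighbour y∈ (inj₂ v⋖y)
        ... | refl = subst₂ _⊆_ (sym new) (sym (φ′-old y∈)) (B⊆u v⋖y)
        q .φ-mono (there x∈)  (here refl) x⋖v with only-neighbour x∈ (inj₁ x⋖v)
        ... | refl = subst₂ _⊆_ (sym (φ′-old x∈)) (sym new) (u⊆B x⋖v)
        q .φ-mono (there x∈)  (there y∈)  x⋖y =
          subst₂ _⊆_ (sym (φ′-old x∈)) (sym (φ′-old y∈)) (φ-mono p x∈ y∈ x⋖y)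

    -- The vertices of the walk are placed one after another, those already placed being skipped;
    -- the walk may repeat vertices.
    reach : ∀ p {x y} → x ∈ dom p → Walk T x y → ∃ λ q → y ∈ dom q × Extends p q
    reach p x∈ here = p , x∈ , λ z∈ → z∈
    reach p x∈ (step {y = w} xw walk) with w ∈? dom p
    ... | yes w∈ = reach p w∈ walk
    ... | no  w∉ with extend p x∈ w∉ xw
    ...   | q , w∈ , p⊑q with reach q w∈ walk
    ...     | r , y∈ , q⊑r = r , y∈ , q⊑r ∘ p⊑q

    reach-all : ∀ p {x} → x ∈ dom p → ∀ ys → ∃ λ q → (∀ {y} → y ∈ ys → y ∈ dom q) × Extends p q
    reach-all p x∈ []       = p , (λ ()) , λ z∈ → z∈
    reach-all p {x} x∈ (y ∷ ys) with reach-all p x∈ ys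
    ... | q , ys∈ , p⊑q with reach q (p⊑q x∈) (connected x y)
    ...   | r , y∈ , q⊑r = r , (λ { (here refl) → y∈ ; (there z∈) → q⊑r (ys∈ z∈) }) , q⊑r ∘ p⊑q

    module _ {A} (A∈L : A ∈ L) where

      root : Elt T
      root = proj₁ edge

      root-lower : Lower root
      root-lower = proj₂ edge

      start : PartialCopy
      start .dom = root ∷ []
      start .dom-unique = [] ∷ []
      start .dom-conn (here refl) (here refl) = root ∷ [] , [-] , ([] ∷ []) , λ z∈ → z∈
      start .φ _ = A
      start .φ-inj (here refl) (here refl) _ = refl
      start .φ-lower (here refl) _ = A∈L
      start .φ-upper (here refl) hi = contradiction hi (Lower∧Upper⇒⊥ root-lower)
      start .φ-mono (here refl) (here refl) _ = λ z∈ → z∈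

      -- Once every element is placed, lower elements have images of size `i` and upper ones of size
      -- `j`, so the copy preserves the ranks given by `rank`.
      copy : ∀ {F i j} → (∀ {A} → A ∈ L → A ∈ F × ∣ A ∣ ≡ i) → (∀ {B} → B ∈ U → B ∈ F × ∣ B ∣ ≡ j) →
             HasRPCopy T n F
      copy {F} {i} {j} L⊆ U⊆ with reach-all start (here refl) (allFin size)
      ... | q , all∈ , _ = rank , rank-isRankFunction , φ q
          , φ-inj q (∈dom _) (∈dom _) , in-F , mono , same-level
        where
        ∈dom : ∀ x → x ∈ dom q
        ∈dom x = all∈ (∈-allFin x)
        in-F : ∀ x → φ q x ∈ F
        in-F x = [ (λ lo → proj₁ (L⊆ (φ-lower q (∈dom x) lo))) , (λ hi → proj₁ (U⊆ (φ-upper q (∈dom x) hi))) ]′ (side x)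
        mono : ∀ x y → x ≼ y → φ q x ⊆ φ q y
        mono x y x≼y with x Fin.≟ y
        ... | yes refl = λ z∈ → z∈
        ... | no x≢y   = φ-mono q (∈dom x) (∈dom y) (≺⇒Covers (x≼y , x≢y))
        level : ℕ → ℕ
        level zero    = i
        level (suc _) = j
        size-level : ∀ x → ∣ φ q x ∣ ≡ level (rank x)
        size-level x with side x
        ... | inj₁ lo = proj₂ (L⊆ (φ-lower q (∈dom x) lo))
        ... | inj₂ hi = proj₂ (U⊆ (φ-upper q (∈dom x) hi))
        same-level : ∀ x y → rank x ≡ rank y → ∣ φ q x ∣ ≡ ∣ φ q y ∣
        same-level x y eq = trans (size-level x) (trans (cong level eq) (sym (size-level y)))

  -- The edge bound between two levels of a free family

  module _ {n : ℕ} {F : List (Subset n)} (free : ¬ HasRPCopy T n F) {i j : ℕ} where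

    -- With more than `size` neighbours at every vertex, one is always outside the at most `size`
    -- sets in use, so the greedy embedding never gets stuck.
    high-degree⇒⊥ : ∀ {L U} → Unique L → Unique U →
      (∀ {A} → A ∈ L → A ∈ F × ∣ A ∣ ≡ i) → (∀ {B} → B ∈ U → B ∈ F × ∣ B ∣ ≡ j) →
      (∀ {A} → A ∈ L → size < ∑ U (inc A)) → (∀ {B} → B ∈ U → size < ∑ L (λ A → inc A B)) →
      ∀ {A} → A ∈ L → ⊥
    high-degree⇒⊥ {L} {U} L-unique U-unique L⊆ U⊆ degL degU A∈ = free (Embed.copy L U up down A∈ L⊆ U⊆)
      where
      up : ∀ {A} → A ∈ L → ∀ used → length used ≤ size → ∃ λ B → B ∈ U × A ⊆ B × B ∉ used
      up {A} A∈ used used≤ with fresh _≟ˢ_ used (Unique.filter⁺ (λ B → inc A B ≟ 1) U-unique)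
               (≤-<-trans used≤ (<-≤-trans (degL A∈) (∑≤length-filter (inc A) (inc≤1 A) U)))
      ... | B , B∈ , B∉ with ∈-filter⁻ (λ B → inc A B ≟ 1) B∈
      ...   | B∈U , eq = B , B∈U , inc≡1⇒⊆ A B eq , B∉
      down : ∀ {B} → B ∈ U → ∀ used → length used ≤ size → ∃ λ A → A ∈ L × A ⊆ B × A ∉ used
      down {B} B∈ used used≤ with fresh _≟ˢ_ used (Unique.filter⁺ (λ A → inc A B ≟ 1) L-unique)
               (≤-<-trans used≤ (<-≤-trans (degU B∈) (∑≤length-filter (λ A → inc A B) (λ A → inc≤1 A B) L)))
      ... | A , A∈ , A∉ with ∈-filter⁻ (λ A → inc A B ≟ 1) A∈
      ...   | A∈L , eq = A , A∈L , inc≡1⇒⊆ A B eq , A∉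

    -- Induction on the number of vertices: deleting a vertex of degree at most `size` loses at most
    -- `size` edges.
    edges-bound : ∀ k {L U} → length L + length U ≤ k → Unique L → Unique U →
      (∀ {A} → A ∈ L → A ∈ F × ∣ A ∣ ≡ i) → (∀ {B} → B ∈ U → B ∈ F × ∣ B ∣ ≡ j) →
      edges L U ≤ size * (length L + length U)
    edges-bound zero    {[]} _ _ _ _ _ = z≤n
    edges-bound (suc k) {L} {U} len≤ L-unique U-unique L⊆ U⊆
      with any? (λ A → ∑ U (inc A) ≤? size) L | any? (λ B → ∑ L (λ A → inc A B) ≤? size) U
    ... | yes low | _ with find low
    ...   | A , A∈ , deg≤ with ∈-∃++ A∈
    ...     | xs , ys , refl = begin
      edges (xs ++ A ∷ ys) U                        ≡⟨ edges-removeˡ xs U ⟩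
      ∑ U (inc A) + edges (xs ++ ys) U              ≤⟨ +-mono-≤ deg≤ IH ⟩
      size + size * (length (xs ++ ys) + length U)  ≡⟨ *-suc size _ ⟨
      size * (suc (length (xs ++ ys)) + length U)   ≡⟨ cong (λ l → size * (l + length U)) (length-insert xs) ⟨
      size * (length (xs ++ A ∷ ys) + length U)     ∎
      where
      open ≤-Reasoning
      IH = edges-bound k {xs ++ ys} {U}
             (s≤s⁻¹ (subst (λ l → l + length U ≤ suc k) (length-insert xs) len≤))
             (unique-remove xs L-unique) U-unique (L⊆ ∘ ∈-weaken-++ xs) U⊆
    edges-bound (suc k) {L} {U} len≤ L-unique U-unique L⊆ U⊆ | no _ | yes low with find low
    ...   | B , B∈ , deg≤ with ∈-∃++ B∈
    ...     | xs , ys , refl = begin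
      edges L (xs ++ B ∷ ys)                           ≡⟨ edges-removeʳ xs L ⟩
      ∑ L (λ A → inc A B) + edges L (xs ++ ys)         ≤⟨ +-mono-≤ deg≤ IH ⟩
      size + size * (length L + length (xs ++ ys))     ≡⟨ *-suc size _ ⟨
      size * suc (length L + length (xs ++ ys))        ≡⟨ cong (size *_) length≡ ⟨
      size * (length L + length (xs ++ B ∷ ys))        ∎
      where
      open ≤-Reasoning
      length≡ : length L + length (xs ++ B ∷ ys) ≡ suc (length L + length (xs ++ ys))
      length≡ = trans (cong (length L +_) (length-insert xs)) (+-suc _ _)
      IH = edges-bound k {L} {xs ++ ys} (s≤s⁻¹ (subst (_≤ suc k) length≡ len≤))
             L-unique (unique-remove xs U-unique) L⊆ (U⊆ ∘ ∈-weaken-++ xs)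
    -- No vertex of low degree is left. Either `L` is empty and there are no edges, or a member of
    -- `L` starts a copy of the tree.
    edges-bound (suc k) {[]}     _ _ _ _ _ | no _ | no _ = z≤n
    edges-bound (suc k) {_ ∷ _} _ L-unique U-unique L⊆ U⊆ | no ¬lowL | no ¬lowU =
      contradiction (here refl) (high-degree⇒⊥ L-unique U-unique L⊆ U⊆
        (λ A∈ → ≰⇒> (¬lowL ∘ lose A∈)) (λ B∈ → ≰⇒> (¬lowU ∘ lose B∈)))

  -- A covering pair would go to nested sets of equal size, hence to equal sets.
  layer-free : ∀ n k → ¬ HasRPCopy T n (layer n k)
  layer-free n k (_ , _ , φ , φ-inj , φ∈ , φ-mono , _) with edge
  ... | a , b , (a≼b , a≢b) , _ = a≢b (φ-inj (⊆∧∣≥∣⇒≡ (φ-mono a b a≼b)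
          (≤-reflexive (trans (layer-size n k (φ∈ b)) (sym (layer-size n k (φ∈ a)))))))

  HasRPCopy-mono : ∀ {n F G} → (∀ {A} → A ∈ F → A ∈ G) → HasRPCopy T n F → HasRPCopy T n G
  HasRPCopy-mono F⊆G (ρ , ρ-rank , φ , φ-inj , φ∈ , rest) = ρ , ρ-rank , φ , φ-inj , F⊆G ∘ φ∈ , rest

  -- The weighted count on the central levels

  module _ {n p : ℕ} {M : List (Subset n)} (M-unique : Unique M) (free : ¬ HasRPCopy T n M)
           (1≤p : 1 ≤ p) (central : ∀ {A} → A ∈ M → Central (suc p) A) where

    level : ℕ → List (Subset n)
    level i = filter (λ A → i ≟ ∣ A ∣) M

    -- `D` is the common denominator in the estimates by `γ`, `Γ` bounds the sum of `γ` over either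
    -- index, and `W` is n! times the LYM sum of `M`.
    D Γ W : ℕ
    D = p * suc p
    Γ = p + 2 * suc n
    W = ∑ M (λ A → weight n ∣ A ∣)

    ℓw : ℕ → ℕ
    ℓw i = length (level i) * weight n i

    ∈-level : ∀ {i A} → A ∈ level i → A ∈ M × ∣ A ∣ ≡ i
    ∈-level {i} A∈ with ∈-filter⁻ (λ A → i ≟ ∣ A ∣) A∈
    ... | A∈M , eq = A∈M , sym eq

    ∑-levels : (g : Subset n → ℕ) → ∑ M g ≡ ∑ (upTo (suc n)) (λ i → ∑ (level i) g)
    ∑-levels = ∑-fibres ∣_∣ n ∣p∣≤n M

    W≡∑ℓw : W ≡ ∑ (upTo (suc n)) ℓw
    W≡∑ℓw = trans (∑-levels _) (∑-cong (upTo (suc n)) (λ {i} _ →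
      trans (∑-cong (level i) (λ A∈ → cong (weight n) (proj₂ (∈-level A∈)))) (∑-const (level i) _)))

    -- On a block of two levels `pairWeight` is constant, which leaves the number of edges as a
    -- factor.
    pairs≡ : ∑ M (λ A → ∑ M (λ B → inc A B * pairWeight n ∣ A ∣ ∣ B ∣))
           ≡ ∑ (upTo (suc n)) (λ i → ∑ (upTo (suc n)) (λ j → edges (level i) (level j) * pairWeight n i j))
    pairs≡ = begin
      ∑ M (λ A → ∑ M (λ B → inc A B * pairWeight n ∣ A ∣ ∣ B ∣))
        ≡⟨ ∑-levels _ ⟩
      ∑ I (λ i → ∑ (level i) (λ A → ∑ M (λ B → inc A B * pairWeight n ∣ A ∣ ∣ B ∣)))
        ≡⟨ ∑-cong I (λ {i} _ → ∑-cong (level i) (λ _ → ∑-levels _)) ⟩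
      ∑ I (λ i → ∑ (level i) (λ A → ∑ I (λ j → ∑ (level j) (λ B → inc A B * pairWeight n ∣ A ∣ ∣ B ∣))))
        ≡⟨ ∑-cong I (λ {i} _ → ∑-swap (level i) I _) ⟩
      ∑ I (λ i → ∑ I (λ j → ∑ (level i) (λ A → ∑ (level j) (λ B → inc A B * pairWeight n ∣ A ∣ ∣ B ∣))))
        ≡⟨ ∑-cong I (λ {i} _ → ∑-cong I (λ {j} _ → block i j)) ⟩
      ∑ I (λ i → ∑ I (λ j → edges (level i) (level j) * pairWeight n i j)) ∎
      where
      open ≡-Reasoning
      I = upTo (suc n)
      block : ∀ i j → ∑ (level i) (λ A → ∑ (level j) (λ B → inc A B * pairWeight n ∣ A ∣ ∣ B ∣))
                    ≡ edges (level i) (level j) * pairWeight n i j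
      block i j = trans
        (∑-cong (level i) (λ {A} A∈ → trans
          (∑-cong (level j) (λ {B} B∈ → cong (inc A B *_)
             (cong₂ (pairWeight n) (proj₂ (∈-level A∈)) (proj₂ (∈-level B∈)))))
          (∑-*ʳ (pairWeight n i j) (level j) (inc A))))
        (∑-*ʳ (pairWeight n i j) (level i) _)

    -- The edge bound charges `size` edges to every vertex of the two levels. Those charged to level
    -- `i` are estimated by `pairWeight≤weight-lower`, those charged to level `j` by
    -- `pairWeight≤weight-upper`.
    block-bound : ∀ i j → D * (edges (level i) (level j) * pairWeight n i j)
                        ≤ size * (γ p i j * ℓw i + γ p i j * ℓw j)
    block-bound i j with i <? j
    ... | no i≮j = ≤-trans (≤-reflexive (trans (cong (D *_) (*-zeroʳ (edges (level i) (level j)))) (*-zeroʳ D))) z≤n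
    ... | yes i<j with edges-empty (level i) (level j)
    ...   | inj₁ e≡0 rewrite e≡0 | *-zeroʳ D = z≤n
    ...   | inj₂ ((A , A∈) , (B , B∈)) = begin
      D * (e * c)                                    ≡⟨ *-swapˡ D e c ⟩
      e * (D * c)                                    ≤⟨ *-monoˡ-≤ (D * c) e≤ ⟩
      size * (ℓi + ℓj) * (D * c)                     ≡⟨ distrib size ℓi ℓj (D * c) ⟩
      size * (ℓi * (D * c) + ℓj * (D * c))
        ≤⟨ *-monoʳ-≤ size (+-mono-≤ (*-monoʳ-≤ ℓi Dc≤i) (*-monoʳ-≤ ℓj Dc≤j)) ⟩
      size * (ℓi * (γ p i j * weight n i) + ℓj * (γ p i j * weight n j))
        ≡⟨ cong (size *_) (cong₂ _+_ (*-swapˡ ℓi (γ p i j) _) (*-swapˡ ℓj (γ p i j) _)) ⟩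
      size * (γ p i j * ℓw i + γ p i j * ℓw j) ∎
      where
      open ≤-Reasoning
      e c ℓi ℓj : ℕ
      e = edges (level i) (level j)
      -- The form of `pairWeight n i j` after the match on `i <? j`.
      c = 1 * (i ! * (j ∸ i) ! * (n ∸ j) !)
      ℓi = length (level i)
      ℓj = length (level j)
      level-unique : ∀ i → Unique (level i)
      level-unique i = Unique.filter⁺ (λ A → i ≟ ∣ A ∣) M-unique
      e≤ : e ≤ size * (ℓi + ℓj)
      e≤ = edges-bound free _ ≤-refl (level-unique i) (level-unique j) ∈-level ∈-level
      p<i : suc p ≤ i
      p<i = subst (suc p ≤_) (proj₂ (∈-level A∈)) (proj₁ (central (proj₁ (∈-level A∈))))
      j+p<n : j + suc p ≤ n
      j+p<n = subst (λ k → k + suc p ≤ n) (proj₂ (∈-level B∈)) (proj₂ (central (proj₁ (∈-level B∈))))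
      c≡ : c ≡ pairWeight n i j
      c≡ = cong (_* (i ! * (j ∸ i) ! * (n ∸ j) !)) (sym (ind-yes (i <? j) i<j))
      Dc≤i : D * c ≤ γ p i j * weight n i
      Dc≤i = ≤-trans (≤-reflexive (cong (D *_) c≡)) (pairWeight≤weight-lower 1≤p p<i i<j j+p<n)
      Dc≤j : D * c ≤ γ p i j * weight n j
      Dc≤j = ≤-trans (≤-reflexive (cong (D *_) c≡)) (pairWeight≤weight-upper 1≤p p<i i<j j+p<n)
      distrib : ∀ s a b x → s * (a + b) * x ≡ s * (a * x + b * x)
      distrib = solve-∀

    -- In the sum of `block-bound` over all blocks, each level is met once as the lower and once as
    -- the upper one, each time with total coefficient at most `Γ`; hence the factor 2.
    weighted-count : D * W ≤ D * n ! + size * (2 * (Γ * W))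
    weighted-count = begin
      D * W
        ≤⟨ *-monoʳ-≤ D (chain-inequality M-unique) ⟩
      D * (n ! + ∑ M (λ A → ∑ M (λ B → inc A B * pairWeight n ∣ A ∣ ∣ B ∣)))
        ≡⟨ cong (λ x → D * (n ! + x)) pairs≡ ⟩
      D * (n ! + ∑ I (λ i → ∑ I (λ j → edges (level i) (level j) * pairWeight n i j)))
        ≡⟨ *-distribˡ-+ D (n !) _ ⟩
      D * n ! + D * ∑ I (λ i → ∑ I (λ j → edges (level i) (level j) * pairWeight n i j))
        ≡⟨ cong (D * n ! +_) (trans (sym (∑-*ˡ D I _)) (∑-cong I (λ _ → sym (∑-*ˡ D I _)))) ⟩
      D * n ! + ∑ I (λ i → ∑ I (λ j → D * (edges (level i) (level j) * pairWeight n i j)))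
        ≤⟨ +-monoʳ-≤ (D * n !) (∑-mono I (λ {i} _ → ∑-mono I (λ {j} _ → block-bound i j))) ⟩
      D * n ! + ∑ I (λ i → ∑ I (λ j → size * (γ p i j * ℓw i + γ p i j * ℓw j)))
        ≡⟨ cong (D * n ! +_) (trans (∑-cong I (λ _ → ∑-*ˡ size I _)) (∑-*ˡ size I _)) ⟩
      D * n ! + size * ∑ I (λ i → ∑ I (λ j → γ p i j * ℓw i + γ p i j * ℓw j))
        ≡⟨ cong (λ x → D * n ! + size * x) (trans
             (∑-cong I (λ {i} _ → ∑-+ I (λ j → γ p i j * ℓw i) (λ j → γ p i j * ℓw j)))
             (∑-+ I (λ i → ∑ I (λ j → γ p i j * ℓw i)) (λ i → ∑ I (λ j → γ p i j * ℓw j)))) ⟩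
      D * n ! + size * (∑ I (λ i → ∑ I (λ j → γ p i j * ℓw i)) + ∑ I (λ i → ∑ I (λ j → γ p i j * ℓw j)))
        ≤⟨ +-monoʳ-≤ (D * n !) (*-monoʳ-≤ size (+-mono-≤ lower upper)) ⟩
      D * n ! + size * (Γ * W + Γ * W)
        ≡⟨ cong (λ x → D * n ! + size * x) (cong (Γ * W +_) (sym (+-identityʳ _))) ⟩
      D * n ! + size * (2 * (Γ * W)) ∎
      where
      open ≤-Reasoning
      I = upTo (suc n)
      lower : ∑ I (λ i → ∑ I (λ j → γ p i j * ℓw i)) ≤ Γ * W
      lower = begin
        ∑ I (λ i → ∑ I (λ j → γ p i j * ℓw i))  ≡⟨ ∑-cong I (λ {i} _ → ∑-*ʳ (ℓw i) I (γ p i)) ⟩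
        ∑ I (λ i → ∑ I (γ p i) * ℓw i)          ≤⟨ ∑-mono I (λ {i} _ → *-monoˡ-≤ (ℓw i) (∑-γ-upper p (suc n) i)) ⟩
        ∑ I (λ i → Γ * ℓw i)                    ≡⟨ ∑-*ˡ Γ I ℓw ⟩
        Γ * ∑ I ℓw                              ≡⟨ cong (Γ *_) W≡∑ℓw ⟨
        Γ * W                                   ∎
      upper : ∑ I (λ i → ∑ I (λ j → γ p i j * ℓw j)) ≤ Γ * W
      upper = begin
        ∑ I (λ i → ∑ I (λ j → γ p i j * ℓw j))  ≡⟨ ∑-swap I I _ ⟩
        ∑ I (λ j → ∑ I (λ i → γ p i j * ℓw j))  ≡⟨ ∑-cong I (λ {j} _ → ∑-*ʳ (ℓw j) I (λ i → γ p i j)) ⟩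
        ∑ I (λ j → ∑ I (λ i → γ p i j) * ℓw j)  ≤⟨ ∑-mono I (λ {j} _ → *-monoˡ-≤ (ℓw j) (∑-γ-lower p (suc n) j)) ⟩
        ∑ I (λ j → Γ * ℓw j)                    ≡⟨ ∑-*ˡ Γ I ℓw ⟩
        Γ * ∑ I ℓw                              ≡⟨ cong (Γ *_) W≡∑ℓw ⟨
        Γ * W                                   ∎

    -- Each member has weight n! / C(n,k), which is at least n! over the middle coefficient.
    length*n!≤ : length M * n ! ≤ midBinom n * W
    length*n!≤ = begin
      length M * n !                            ≡⟨ ∑-const M (n !) ⟨
      ∑ M (λ _ → n !)                           ≤⟨ ∑-mono M (λ {A} _ → n!≤ (∣p∣≤n A)) ⟩
      ∑ M (λ A → midBinom n * weight n ∣ A ∣)   ≡⟨ ∑-*ˡ (midBinom n) M _ ⟩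
      midBinom n * W                            ∎
      where
      open ≤-Reasoning
      n!≤ : ∀ {k} → k ≤ n → n ! ≤ midBinom n * weight n k
      n!≤ {k} k≤n = ≤-trans (≤-reflexive (sym (C*weight k≤n))) (*-monoˡ-≤ (weight n k) (C≤mid k≤n))

  -- From the weighted count to the size of a free family

  module _ {n p : ℕ} (6q≤n : 6 * suc p ≤ n) (n≤6q+5 : n ≤ 5 + suc p * 6) (p-large : 100 * size + 4 ≤ p) where

    1≤p : 1 ≤ p
    1≤p = ≤-trans (≤-trans (s≤s z≤n) (m≤n+m 4 (100 * size))) p-large

    central-bound : ∀ {M : List (Subset n)} → Unique M → ¬ HasRPCopy T n M →
                    (∀ {A} → A ∈ M → Central (suc p) A) →
                    p * length M ≤ (p + 100 * size) * midBinom n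
    central-bound {M} M-unique free central = *-cancelʳ-≤ _ _ (n !) (begin
      p * length M * n !                          ≡⟨ *-assoc p _ _ ⟩
      p * (length M * n !)                        ≤⟨ *-monoʳ-≤ p (length*n!≤ M-unique free 1≤p central) ⟩
      p * (midBinom n * weights)                  ≡⟨ *-swapˡ p (midBinom n) weights ⟩
      midBinom n * (p * weights)                  ≤⟨ *-monoʳ-≤ (midBinom n) p*weights≤ ⟩
      midBinom n * ((p + 100 * size) * n !)       ≡⟨ regroup (midBinom n) (p + 100 * size) (n !) ⟩
      (p + 100 * size) * midBinom n * n !         ∎)
      where
      open ≤-Reasoning
      instance _ = n !≢0
      weights : ℕ
      weights = ∑ M (λ A → weight n ∣ A ∣)
      regroup : ∀ a b c → a * (b * c) ≡ b * a * c
      regroup = solve-∀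
      expand : ∀ p → p + 2 * suc (5 + suc p * 6) + 12 * p ≡ 25 * p + 24
      expand = solve-∀
      expand′ : ∀ p → 25 * p + 24 + 1 ≡ 25 * suc p
      expand′ = solve-∀
      Γ≤ : p + 2 * suc n ≤ 25 * suc p
      -- As n ≤ 6p + 11, the left side is at most 13p + 24; it is rounded up to a multiple of
      -- `suc p`, the form `absorb` takes.
      Γ≤ = begin
        p + 2 * suc n                            ≤⟨ +-monoʳ-≤ p (*-monoʳ-≤ 2 (s≤s n≤6q+5)) ⟩
        p + 2 * suc (5 + suc p * 6)              ≤⟨ m≤m+n _ (12 * p) ⟩
        p + 2 * suc (5 + suc p * 6) + 12 * p     ≡⟨ expand p ⟩
        25 * p + 24                              ≤⟨ m≤m+n _ 1 ⟩
        25 * p + 24 + 1                          ≡⟨ expand′ p ⟩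
        25 * suc p                               ∎
      p*weights≤ : p * weights ≤ (p + 100 * size) * n !
      p*weights≤ = absorb {t = size} 1≤p (≤-trans (m≤m+n _ 4) p-large) Γ≤
        (weighted-count M-unique free 1≤p central)

    -- The exponential gain of `outer-bound` is weakened by (p + 1)² ≤ 2^(p + 1), to match the order
    -- 1 / p of the central error.
    p*outer≤ : ∀ {G : List (Subset n)} → Unique G → (∀ {A} → A ∈ G → ¬ Central (suc p) A) →
               p * length G ≤ 2 * midBinom n
    p*outer≤ {G} G-unique outer = ≤-trans (*-monoˡ-≤ (length G) (n≤1+n p)) (*-cancelˡ-≤ (suc p) (begin
      suc p * (suc p * length G)   ≡⟨ *-assoc (suc p) (suc p) _ ⟨
      suc p * suc p * length G     ≤⟨ *-monoˡ-≤ (length G) (q²≤2^q (≤-trans (≤-trans (m≤n+m 4 _) p-large) (n≤1+n p))) ⟩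
      2 ^ suc p * length G         ≤⟨ outer-bound 6q≤n G-unique outer ⟩
      suc p * (2 * midBinom n)     ∎))
      where open ≤-Reasoning

    family-bound : ∀ {F : List (Subset n)} → Unique F → ¬ HasRPCopy T n F →
                   p * length F ≤ p * midBinom n + (100 * size + 2) * midBinom n
    family-bound {F} F-unique free = begin
      p * length F
        ≤⟨ *-monoʳ-≤ p (unique-⊆-length F-unique covered) ⟩
      p * length (M ++ G)
        ≡⟨ trans (cong (p *_) (length-++ M)) (*-distribˡ-+ p _ _) ⟩
      p * length M + p * length G
        ≤⟨ +-mono-≤
             (central-bound (Unique.filter⁺ (central? (suc p)) F-unique)
               (free ∘ HasRPCopy-mono (proj₁ ∘ ∈-filter⁻ (central? (suc p))))
               (proj₂ ∘ ∈-filter⁻ (central? (suc p)) {xs = F}))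
             (p*outer≤ (Unique.filter⁺ (¬? ∘ central? (suc p)) F-unique)
               (proj₂ ∘ ∈-filter⁻ (¬? ∘ central? (suc p)) {xs = F})) ⟩
      (p + 100 * size) * midBinom n + 2 * midBinom n
        ≡⟨ regroup p (100 * size) (midBinom n) ⟩
      p * midBinom n + (100 * size + 2) * midBinom n ∎
      where
      open ≤-Reasoning
      M G : List (Subset n)
      M = filter (central? (suc p)) F
      G = filter (¬? ∘ central? (suc p)) F
      regroup : ∀ p a b → (p + a) * b + 2 * b ≡ p * b + (a + 2) * b
      regroup = solve-∀
      covered : ∀ {A} → A ∈ F → A ∈ M ++ G
      covered {A} A∈ with central? (suc p) A
      ... | yes c = ∈-++⁺ˡ (∈-filter⁺ (central? (suc p)) A∈ c)
      ... | no ¬c = ∈-++⁺ʳ M (∈-filter⁺ (¬? ∘ central? (suc p)) A∈ ¬c)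

    -- The middle layer is free, so `m` is at least the middle coefficient and the distance is a
    -- plain difference. `family-bound` controls `p` times it, and n ≤ 6p + 11 ≤ 17p trades `p` for
    -- `n`.
    deviation-bound : ∀ {m} → IsLaRP T n m →
                      n * ∣ m - midBinom n ∣ ≤ 17 * (100 * size + 2) * midBinom n
    deviation-bound {m} ((F , F-unique , free , refl) , maximal) = begin
      n * ∣ m - b ∣                   ≡⟨ cong (n *_) (m≤n⇒∣n-m∣≡n∸m b≤m) ⟩
      n * (m ∸ b)                     ≤⟨ *-monoˡ-≤ (m ∸ b) n≤17p ⟩
      17 * p * (m ∸ b)                ≡⟨ *-assoc 17 p _ ⟩
      17 * (p * (m ∸ b))              ≡⟨ cong (17 *_) (*-distribˡ-∸ p m b) ⟩
      17 * (p * m ∸ p * b)            ≤⟨ *-monoʳ-≤ 17 (m≤n+o⇒m∸n≤o (p * m) (p * b) (family-bound F-unique free)) ⟩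
      17 * ((100 * size + 2) * b)     ≡⟨ *-assoc 17 (100 * size + 2) b ⟨
      17 * (100 * size + 2) * b       ∎
      where
      open ≤-Reasoning
      b : ℕ
      b = midBinom n
      b≤m : b ≤ m
      b≤m = subst (_≤ m) (length-layer n (n / 2))
              (maximal (layer n (n / 2)) (layer-unique n (n / 2)) (layer-free n (n / 2)))
      expand : ∀ p → 5 + suc p * 6 ≡ 11 * 1 + 6 * p
      expand = solve-∀
      expand′ : ∀ p → 11 * p + 6 * p ≡ 17 * p
      expand′ = solve-∀
      n≤17p : n ≤ 17 * p
      n≤17p = begin
        n                 ≤⟨ n≤6q+5 ⟩
        5 + suc p * 6     ≡⟨ expand p ⟩
        11 * 1 + 6 * p    ≤⟨ +-monoˡ-≤ (6 * p) (*-monoʳ-≤ 11 1≤p) ⟩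
        11 * p + 6 * p    ≡⟨ expand′ p ⟩
        17 * p            ∎

theorem1p2 : (T : FinPoset) → IsTreePoset T → HeightIs T 2 →
    Σ ℕ λ C → Σ ℕ λ N → ∀ (n m : ℕ) → N ≤ n → IsLaRP T n m →
    n * (∣ m - midBinom n ∣ * ∣ m - midBinom n ∣)
    ≤ C * ⌊log₂ n ⌋ * (midBinom n * midBinom n)
-- The constant is the square of the one in `deviation-bound`. The threshold makes n / 6 at least
-- `100 * size + 5`, so its predecessor `p` satisfies `p-large`.
theorem1p2 T (_ , connected , acyclic) height2 = K * K , (100 * size + 5) * 6 , bound
  where
  open FinPoset T using (size)
  open ≤-Reasoning
  K : ℕ
  K = 17 * (100 * size + 2)
  rearrange : ∀ n d → n * d * (n * d) ≡ n * (n * (d * d))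
  rearrange = solve-∀
  rearrange′ : ∀ k b → k * b * (k * b) ≡ k * k * 1 * (b * b)
  rearrange′ = solve-∀
  bound : ∀ n m → (100 * size + 5) * 6 ≤ n → IsLaRP T n m →
          n * (∣ m - midBinom n ∣ * ∣ m - midBinom n ∣) ≤ K * K * ⌊log₂ n ⌋ * (midBinom n * midBinom n)
  bound n m N≤n isLa = begin
    -- An extra factor `n` completes the square of `n * d`.
    n * (d * d)                        ≤⟨ *-monoʳ-≤ n (m≤n*m (d * d) n) ⟩
    n * (n * (d * d))                  ≡⟨ rearrange n d ⟨
    n * d * (n * d)                    ≤⟨ *-mono-≤ nd≤ nd≤ ⟩
    K * b * (K * b)                    ≡⟨ rearrange′ K b ⟩
    -- The factor 1 gives way to the logarithm, which is at least 1 since `2 ≤ n`.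
    K * K * 1 * (b * b)                ≤⟨ *-monoˡ-≤ (b * b) (*-monoʳ-≤ (K * K) 1≤log) ⟩
    K * K * ⌊log₂ n ⌋ * (b * b)        ∎
    where
    d b q p : ℕ
    d = ∣ m - midBinom n ∣
    b = midBinom n
    q = n / 6
    p = pred q
    2≤n : 2 ≤ n
    2≤n = ≤-trans (≤-trans (s≤s (s≤s z≤n)) (*-monoˡ-≤ 6 (m≤n+m 5 (100 * size)))) N≤n
    instance _ = >-nonZero (≤-trans (s≤s z≤n) 2≤n)
    1≤log : 1 ≤ ⌊log₂ n ⌋
    1≤log = subst (_≤ ⌊log₂ n ⌋) (⌊log₂[2^n]⌋≡n 1) (⌊log₂⌋-mono-≤ 2≤n)
    q-large : 100 * size + 5 ≤ q
    q-large = ≤-trans (≤-reflexive (sym (m*n/n≡m (100 * size + 5) 6))) (/-monoˡ-≤ 6 N≤n)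
    q≡ : suc p ≡ q
    q≡ = suc-pred q {{>-nonZero (≤-trans (≤-trans (s≤s z≤n) (m≤n+m 5 (100 * size))) q-large)}}
    p-large : 100 * size + 4 ≤ p
    p-large = s≤s⁻¹ (subst₂ _≤_ (+-suc (100 * size) 4) (sym q≡) q-large)
    6q≤n : 6 * suc p ≤ n
    6q≤n = ≤-trans (≤-reflexive (trans (*-comm 6 (suc p)) (cong (_* 6) q≡))) (m/n*n≤m n 6)
    n≤6q+5 : n ≤ 5 + suc p * 6
    n≤6q+5 = begin
      n                    ≡⟨ m≡m%n+[m/n]*n n 6 ⟩
      n % 6 + n / 6 * 6    ≤⟨ +-mono-≤ (s≤s⁻¹ (m%n<n n 6)) (≤-reflexive (cong (_* 6) (sym q≡))) ⟩
      5 + suc p * 6        ∎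
    nd≤ : n * d ≤ K * b
    nd≤ = HeightTwoTree.deviation-bound T connected acyclic height2 6q≤n n≤6q+5 p-large isLa
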